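{- For any integer $\gamma \geq 0$, the operad $\mathsf{Trias}_\gamma$ admits the following presentation. It is generated by $\{\dashv_a, \perp, \vdash_a : a \in [\gamma]\}$ (all generators being of arity $2$) and its space of relations is the space induced by the equivalence relation $\leftrightarrow_\gamma$ satisfying $$\perp \circ_1 \perp \;\leftrightarrow_\gamma\; \perp \circ_2 \perp,$$ $$\dashv_a \circ_1 \perp \;\leftrightarrow_\gamma\; \perp \circ_2 \dashv_a, \qquad a \in [\gamma],$$ $$\perp \circ_1 \vdash_a \;\leftrightarrow_\gamma\; \vdash_a \circ_2 \perp, \qquad a \in [\gamma],$$ $$\perp \circ_1 \dashv_a \;\leftrightarrow_\gamma\; \perp \circ_2 \vdash_a, \qquad a \in [\gamma],$$ $$\dashv_a \circ_1 \vdash_{a'} \;\leftrightarrow_\gamma\; \vdash_{a'} \circ_2 \dashv_a, \qquad a, a' \in [\gamma],$$ $$\dashv_a \circ_1 \dashv_b \;\leftrightarrow_\gamma\; \dashv_a \circ_2 \vdash_b, \qquad a < b \in [\gamma],$$ $$\vdash_a \circ_1 \dashv_b \;\leftrightarrow_\gamma\; \vdash_a \circ_2 \vdash_b, \qquad a < b \in [\gamma],$$ $$\dashv_b \circ_1 \dashv_a \;\leftrightarrow_\gamma\; \dashv_a \circ_2 \dashv_b, \qquad a < b \in [\gamma],$$ $$\vdash_a \circ_1 \vdash_b \;\leftrightarrow_\gamma\; \vdash_b \circ_2 \vdash_a, \qquad a < b \in [\gamma],$$ $$\dashv_d \circ_1 \dashv_d \;\leftrightarrow_\gamma\; \dashv_d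 \circ_2 \perp \;\leftrightarrow_\gamma\; \dashv_d \circ_2 \dashv_c \;\leftrightarrow_\gamma\; \dashv_d \circ_2 \vdash_c, \qquad c \leq d \in [\gamma],$$ $$\vdash_d \circ_1 \dashv_c \;\leftrightarrow_\gamma\; \vdash_d \circ_1 \vdash_c \;\leftrightarrow_\gamma\; \vdash_d \circ_1 \perp \;\leftrightarrow_\gamma\; \vdash_d \circ_2 \vdash_d, \qquad c \leq d \in [\gamma].$$
   Context: The ground field has characteristic zero; $[\gamma]=\{1,\dots,\gamma\}$. Operads are nonsymmetric, described by partial compositions $\circ_i$ and a unit. Let $\mathcal{M}_\gamma$ be the monoid on $\{0\} \cup [\gamma]$ with product $\max$, and $\mathsf{T}\mathcal{M}_\gamma$ the operad whose arity-$n$ component ($n\geq1$) has as basis all words of length $n$ on $\{0\} \cup [\gamma]$, with $u \circ_i v := u_1 \dots u_{i-1}\,\max(u_i, v_1) \dots \max(u_i, v_m)\, u_{i+1} \dots u_n$ and unit the word $0$. $\mathsf{Trias}_\gamma$ is the suboperad of $\mathsf{T}\mathcal{M}_\gamma$ generated by the words $0a$, $00$, $a0$, $a \in [\gamma]$. $\mathbf{Free}(S)$ is the free nonsymmetric operad on a graded set $S$: its basis consists of planar rooted trees whose internal nodes of arity $k$ are labeled by elements of $S$ of arity $k$, and $\mathfrak{s} \circ_i \mathfrak{t}$ grafts the root of $\mathfrak{t}$ on the $i$th leaf of $\mathfrak{s}$. An element of $S$ is identified with the tree having a single internal node with that label. A presentation of an operad $\mathcal{O}$ is a pair $(\mathfrak{G},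 \mathfrak{R})$, $\mathfrak{G}$ a graded set and $\mathfrak{R}$ a subspace of $\mathbf{Free}(\mathfrak{G})$, such that $\mathcal{O} \cong \mathbf{Free}(\mathfrak{G})/\langle\mathfrak{R}\rangle$, with $\langle \mathfrak{R}\rangle$ the operad ideal generated by $\mathfrak{R}$. The space induced by an equivalence relation $\leftrightarrow$ on trees (of equal arity) is the linear span of all $x - x'$ with $x \leftrightarrow x'$. -}

module Defs where

open import Level using (Level; 0ℓ; _⊔_) renaming (suc to lsuc)
open import Algebra.Bundles using (CommutativeRing; CommutativeMonoid)
open import Algebra.Apartness.Bundles using (HeytingField; HeytingCommutativeRing)
open import Algebra.Module.Bundles using (LeftModule)
open import Algebra.Module.Morphism.Structures using (IsLeftModuleIsomorphism)
open import Algebra.Structures using (IsMonoid)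
import Algebra.Definitions.RawMonoid as RawMonoidDefinitions
import Algebra.Properties.Group as GroupProperties
import Algebra.Properties.AbelianGroup as AbelianGroupProperties
import Algebra.Properties.CommutativeSemigroup as CommutativeSemigroupProperties
import Algebra.Construct.NaturalChoice.Max as NaturalChoiceMax
open import Data.Fin.Base as Fin using (Fin; zero; suc; toℕ; fromℕ<; splitAt; _↑ˡ_; _↑ʳ_)
import Data.Fin.Properties as Finₚ
open import Data.List.Base as List using (List; []; _∷_; _++_)
import Data.List.Properties as Listₚ
open import Data.List.NonEmpty.Base as List⁺ using (List⁺; _∷_; _∷⁺_; _⁺++_; toList)
open import Data.Nat.Base as ℕ using (ℕ; zero; suc; z≤n; s≤s)
import Data.Nat.Properties as ℕₚ
open import Data.Nat.Solver using (module +-*-Solver)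
open import Data.Product.Base using (Σ; Σ-syntax; ∃₂; _×_; _,_; proj₁; proj₂)
open import Data.Sum.Base using (inj₁; inj₂; [_,_]′)
open import Data.Vec.Base using (Vec; []; _∷_; replicate)
open import Function.Base using (_∘_; id)
open import Relation.Binary.Core using (Rel)
open import Relation.Binary.Construct.Closure.Equivalence using (EqClosure)
open import Relation.Binary.PropositionalEquality
  using (_≡_; refl; sym; trans; cong; subst; module ≡-Reasoning)
import Relation.Binary.Reasoning.Setoid as SetoidReasoning
open import Relation.Nullary.Negation.Core using (¬_; contradiction)
open import Relation.Unary using (Pred)

fieldRing : ∀ {c ℓ₁ ℓ₂} → HeytingField c ℓ₁ ℓ₂ → CommutativeRing c ℓ₁
fieldRing 𝕂 = HeytingCommutativeRing.commutativeRing (HeytingField.heytingCommutativeRing 𝕂)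

CharacteristicZero : ∀ {c ℓ₁ ℓ₂} → HeytingField c ℓ₁ ℓ₂ → Set ℓ₁
CharacteristicZero 𝕂 = ∀ n → ¬ (suc n ×ᴺ 1# ≈ 0#)
  where
  open CommutativeRing (fieldRing 𝕂)
  open RawMonoidDefinitions +-rawMonoid using () renaming (_×_ to _×ᴺ_)

-- Nonsymmetric operads with values in sets, all arities together.  Positions
-- are counted from 0, so (x ∘ᵢ y) ∘ᵢ₊ⱼ₋₁ z in the usual 1-based numbering
-- becomes (x ∘ᵢ y) ∘ᵢ₊ⱼ z.  A position in a composite is a variable constrained
-- by an equation on its value, which avoids transports along arity equations.

record SetOperad : Set₁ where
  field
    Object : Set
    arity  : Object → ℕ
    one    : Object
    _∘[_]_ : (x : Object) → Fin (arity x) → Object → Object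

    arity-one : arity one ≡ 1
    arity-∘   : ∀ x i y → suc (arity (x ∘[ i ] y)) ≡ arity x ℕ.+ arity y

    identityˡ : ∀ i x → one ∘[ i ] x ≡ x
    identityʳ : ∀ x i → x ∘[ i ] one ≡ x

    sequential : ∀ x y z i j k → toℕ k ≡ toℕ i ℕ.+ toℕ j →
                 (x ∘[ i ] y) ∘[ k ] z ≡ x ∘[ i ] (y ∘[ j ] z)
    parallel   : ∀ x y z i j i′ j′ → toℕ i ℕ.< toℕ j →
                 toℕ i′ ≡ toℕ i → suc (toℕ j′) ≡ toℕ j ℕ.+ arity y →
                 (x ∘[ i ] y) ∘[ j′ ] z ≡ (x ∘[ j ] z) ∘[ i′ ] y

  Component : ℕ → Set
  Component n = Σ[ x ∈ Object ] arity x ≡ n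

  Component-≡ : ∀ {n} {x y : Component n} → proj₁ x ≡ proj₁ y → x ≡ y
  Component-≡ {x = _ , p} {y = _ , q} refl = cong (_ ,_) (ℕₚ.≡-irrelevant p q)

  compose : ∀ {m n p} → suc p ≡ m ℕ.+ n →
            Component m → Fin m → Component n → Component p
  compose e (x , refl) i (y , refl) =
    x ∘[ i ] y , ℕₚ.suc-injective (trans (arity-∘ x i y) (sym e))

module Trees (S : ℕ → Set) where

  data Tree : Set where
    leaf : Tree
    node : ∀ {k} → S k → Vec Tree k → Tree

  mutual
    leaves : Tree → ℕ
    leaves leaf        = 1
    leaves (node _ ts) = leavesᵛ ts

    leavesᵛ : ∀ {k} → Vec Tree k → ℕ
    leavesᵛ []       = 0
    leavesᵛ (t ∷ ts) = leaves t ℕ.+ leavesᵛ ts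

  mutual
    graft : (s : Tree) → Fin (leaves s) → Tree → Tree
    graft leaf        _ t = t
    graft (node a ss) i t = node a (graftᵛ ss i t)

    graftᵛ : ∀ {k} (ss : Vec Tree k) → Fin (leavesᵛ ss) → Tree → Vec Tree k
    graftᵛ (s ∷ ss) i t =
      [ (λ i₁ → graft s i₁ t ∷ ss) , (λ i₂ → s ∷ graftᵛ ss i₂ t) ]′
      (splitAt (leaves s) i)

  corolla : ∀ {k} → S k → Tree
  corolla {k} a = node a (replicate k leaf)

  leaves-corolla : ∀ {k} (a : S k) → leaves (corolla a) ≡ k
  leaves-corolla {k} _ = go k
    where
    go : ∀ k → leavesᵛ (replicate k leaf) ≡ k
    go zero    = refl
    go (suc k) = cong suc (go k)

  data View (m : ℕ) {n : ℕ} (i : Fin (m ℕ.+ n)) : Set where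
    left  : (i₁ : Fin m) → toℕ i ≡ toℕ i₁ → View m i
    right : (i₂ : Fin n) → toℕ i ≡ m ℕ.+ toℕ i₂ → View m i

  view : ∀ m {n} (i : Fin (m ℕ.+ n)) → View m i
  view m {n} i with splitAt m i | Finₚ.join-splitAt m n i
  ... | inj₁ i₁ | refl = left i₁ (Finₚ.toℕ-↑ˡ i₁ n)
  ... | inj₂ i₂ | refl = right i₂ (Finₚ.toℕ-↑ʳ m i₂)

  graft-left : ∀ {k} s (ss : Vec Tree k) i t (i₁ : Fin (leaves s)) →
               toℕ i ≡ toℕ i₁ → graftᵛ (s ∷ ss) i t ≡ graft s i₁ t ∷ ss
  graft-left s ss i t i₁ e
    with refl ← Finₚ.toℕ-injective {i = i} {j = i₁ ↑ˡ leavesᵛ ss}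
                  (trans e (sym (Finₚ.toℕ-↑ˡ i₁ _)))
    rewrite Finₚ.splitAt-↑ˡ (leaves s) i₁ (leavesᵛ ss) = refl

  graft-right : ∀ {k} s (ss : Vec Tree k) i t (i₂ : Fin (leavesᵛ ss)) →
                toℕ i ≡ leaves s ℕ.+ toℕ i₂ → graftᵛ (s ∷ ss) i t ≡ s ∷ graftᵛ ss i₂ t
  graft-right s ss i t i₂ e
    with refl ← Finₚ.toℕ-injective {i = i} {j = leaves s ↑ʳ i₂}
                  (trans e (sym (Finₚ.toℕ-↑ʳ (leaves s) i₂)))
    rewrite Finₚ.splitAt-↑ʳ (leaves s) (leavesᵛ ss) i₂ = refl

  leftOf : ∀ m {n} (i : Fin (m ℕ.+ n)) → toℕ i ℕ.< m → Σ[ i₁ ∈ Fin m ] toℕ i ≡ toℕ i₁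
  leftOf m i lt = fromℕ< lt , sym (Finₚ.toℕ-fromℕ< lt)

  rightOf : ∀ m {n} (i : Fin (m ℕ.+ n)) {j} → toℕ i ≡ m ℕ.+ j →
            Σ[ i₂ ∈ Fin n ] toℕ i ≡ m ℕ.+ toℕ i₂ × toℕ i₂ ≡ j
  rightOf m i e with view m i
  ... | left i₁ e₁  = contradiction (subst (ℕ._< m) (trans (sym e₁) e) (Finₚ.toℕ<n i₁))
                                    (ℕₚ.m+n≮m m _)
  ... | right i₂ e₂ = i₂ , e₂ , ℕₚ.+-cancelˡ-≡ m _ _ (trans (sym e₂) e)

  mutual
    leaves-graft : ∀ s i t → suc (leaves (graft s i t)) ≡ leaves s ℕ.+ leaves t
    leaves-graft leaf        _ t = refl
    leaves-graft (node _ ss) i t = leaves-graftᵛ ss i t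

    leaves-graftᵛ : ∀ {k} (ss : Vec Tree k) i t →
                    suc (leavesᵛ (graftᵛ ss i t)) ≡ leavesᵛ ss ℕ.+ leaves t
    leaves-graftᵛ (s ∷ ss) i t with view (leaves s) i
    ... | left i₁ e rewrite graft-left s ss i t i₁ e = begin
      suc (leaves (graft s i₁ t)) ℕ.+ leavesᵛ ss ≡⟨ cong (ℕ._+ leavesᵛ ss) (leaves-graft s i₁ t) ⟩
      leaves s ℕ.+ leaves t ℕ.+ leavesᵛ ss       ≡⟨ solve 3 (λ a b c → a :+ b :+ c := a :+ c :+ b)
                                                      refl (leaves s) (leaves t) (leavesᵛ ss) ⟩
      leaves s ℕ.+ leavesᵛ ss ℕ.+ leaves t       ∎
      where
      open ≡-Reasoning
      open +-*-Solver
    ... | right i₂ e rewrite graft-right s ss i t i₂ e = begin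
      suc (leaves s ℕ.+ leavesᵛ (graftᵛ ss i₂ t)) ≡⟨ ℕₚ.+-suc (leaves s) _ ⟨
      leaves s ℕ.+ suc (leavesᵛ (graftᵛ ss i₂ t)) ≡⟨ cong (leaves s ℕ.+_) (leaves-graftᵛ ss i₂ t) ⟩
      leaves s ℕ.+ (leavesᵛ ss ℕ.+ leaves t)      ≡⟨ ℕₚ.+-assoc (leaves s) _ _ ⟨
      leaves s ℕ.+ leavesᵛ ss ℕ.+ leaves t        ∎
      where
      open ≡-Reasoning

  mutual
    graft-leaf : ∀ s i → graft s i leaf ≡ s
    graft-leaf leaf        zero = refl
    graft-leaf (node a ss) i    = cong (node a) (graftᵛ-leaf ss i)

    graftᵛ-leaf : ∀ {k} (ss : Vec Tree k) i → graftᵛ ss i leaf ≡ ss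
    graftᵛ-leaf (s ∷ ss) i with view (leaves s) i
    ... | left i₁ e  = trans (graft-left s ss i leaf i₁ e) (cong (_∷ ss) (graft-leaf s i₁))
    ... | right i₂ e = trans (graft-right s ss i leaf i₂ e) (cong (s ∷_) (graftᵛ-leaf ss i₂))

  -- u, v, w stand for the arities of x, y and x ∘ᵢ y.
  position< : ∀ {u v w i j} → suc w ≡ u ℕ.+ v → i ℕ.< u → j ℕ.< v → i ℕ.+ j ℕ.< w
  position< {i = i} {j} e i<u j<v = ℕ.s≤s⁻¹ (begin
    suc (suc (i ℕ.+ j)) ≡⟨ cong suc (ℕₚ.+-suc i j) ⟨
    suc i ℕ.+ suc j     ≤⟨ ℕₚ.+-mono-≤ i<u j<v ⟩
    _                   ≡⟨ e ⟨
    _                   ∎)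
    where
    open ℕₚ.≤-Reasoning

  subst₂< : ∀ {a b c d} → a ≡ c → b ≡ d → a ℕ.< b → c ℕ.< d
  subst₂< refl refl = id

  cancel< : ∀ n {a b c d} → a ≡ n ℕ.+ c → b ≡ n ℕ.+ d → a ℕ.< b → c ℕ.< d
  cancel< n refl refl = ℕₚ.+-cancelˡ-< n _ _

  <-composite : ∀ {a b c d w} → suc w ≡ c ℕ.+ d → a ℕ.< b → b ℕ.< c → a ℕ.< w
  <-composite {c = c} {d} e a<b b<c = ℕₚ.<-≤-trans a<b
    (ℕ.s≤s⁻¹ (ℕₚ.≤-trans b<c (ℕₚ.≤-trans (ℕₚ.m≤m+n c d) (ℕₚ.≤-reflexive (sym e)))))

  shifted-< : ∀ {a b c d w} → suc a ≡ b ℕ.+ d → suc w ≡ c ℕ.+ d → b ℕ.< c → a ℕ.< w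
  shifted-< {d = d} e₁ e₂ b<c =
    ℕ.s≤s⁻¹ (ℕₚ.≤-trans (ℕₚ.≤-reflexive (cong suc e₁))
              (ℕₚ.≤-trans (ℕₚ.+-monoˡ-≤ d b<c) (ℕₚ.≤-reflexive (sym e₂))))

  pred-shift : ∀ a {b c d} → 0 ℕ.< b → suc d ≡ a ℕ.+ b ℕ.+ c → d ≡ a ℕ.+ ℕ.pred (b ℕ.+ c)
  pred-shift a {suc b} {c} (s≤s z≤n) e = ℕₚ.suc-injective
    (trans e (trans (ℕₚ.+-assoc a (suc b) c) (ℕₚ.+-suc a (b ℕ.+ c))))

  right-shift : ∀ {a b c d j w} → suc w ≡ d ℕ.+ c → j ≡ d ℕ.+ b → suc a ≡ j ℕ.+ c → a ≡ w ℕ.+ b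
  right-shift {b = b} {c} {d} e refl e′ = ℕₚ.suc-injective
    (trans e′ (trans (solve 3 (λ d b c → d :+ b :+ c := d :+ c :+ b) refl d b c)
                     (cong (ℕ._+ b) (sym e))))
    where
    open +-*-Solver

  mutual
    graft-sequential : ∀ s i t j u {w} → w ≡ graft s i t → (k : Fin (leaves w)) →
                       toℕ k ≡ toℕ i ℕ.+ toℕ j → graft w k u ≡ graft s i (graft t j u)
    graft-sequential leaf        zero t j u refl k e =
      cong (λ k → graft t k u) (Finₚ.toℕ-injective e)
    graft-sequential (node a ss) i    t j u refl k e =
      cong (node a) (graftᵛ-sequential ss i t j u refl k e)

    graftᵛ-sequential : ∀ {n} (ss : Vec Tree n) i t j u {ws : Vec Tree n} →
                        ws ≡ graftᵛ ss i t → (k : Fin (leavesᵛ ws)) →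
                        toℕ k ≡ toℕ i ℕ.+ toℕ j → graftᵛ ws k u ≡ graftᵛ ss i (graft t j u)
    graftᵛ-sequential (s ∷ ss) i t j u eq k e with view (leaves s) i
    ... | left i₁ ei
      with refl ← trans eq (graft-left s ss i t i₁ ei)
      with e′ ← trans e (cong (ℕ._+ toℕ j) ei)
      with k₁ , ek ← leftOf (leaves (graft s i₁ t)) k (subst (ℕ._< _) (sym e′)
             (position< (leaves-graft s i₁ t) (Finₚ.toℕ<n i₁) (Finₚ.toℕ<n j))) = begin
      graftᵛ (graft s i₁ t ∷ ss) k u ≡⟨ graft-left _ ss k u k₁ ek ⟩
      graft (graft s i₁ t) k₁ u ∷ ss ≡⟨ cong (_∷ ss) (graft-sequential s i₁ t j u refl k₁ (trans (sym ek) e′)) ⟩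
      graft s i₁ (graft t j u) ∷ ss  ≡⟨ graft-left s ss i _ i₁ ei ⟨
      graftᵛ (s ∷ ss) i (graft t j u) ∎
      where
      open ≡-Reasoning
    ... | right i₂ ei
      with refl ← trans eq (graft-right s ss i t i₂ ei)
      with k₂ , ek , ek₂ ← rightOf (leaves s) k
             (trans e (trans (cong (ℕ._+ toℕ j) ei) (ℕₚ.+-assoc (leaves s) _ _))) = begin
      graftᵛ (s ∷ graftᵛ ss i₂ t) k u ≡⟨ graft-right s _ k u k₂ ek ⟩
      s ∷ graftᵛ (graftᵛ ss i₂ t) k₂ u ≡⟨ cong (s ∷_) (graftᵛ-sequential ss i₂ t j u refl k₂ ek₂) ⟩
      s ∷ graftᵛ ss i₂ (graft t j u)  ≡⟨ graft-right s ss i _ i₂ ei ⟨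
      graftᵛ (s ∷ ss) i (graft t j u) ∎
      where
      open ≡-Reasoning

  mutual
    graft-parallel : ∀ s t u i j {w₁ w₂} → w₁ ≡ graft s i t → w₂ ≡ graft s j u →
                     (i′ : Fin (leaves w₂)) (j′ : Fin (leaves w₁)) → toℕ i ℕ.< toℕ j →
                     toℕ i′ ≡ toℕ i → suc (toℕ j′) ≡ toℕ j ℕ.+ leaves t →
                     graft w₁ j′ u ≡ graft w₂ i′ t
    graft-parallel leaf        t u zero zero _    _    _  _  ()
    graft-parallel (node a ss) t u i    j    refl refl i′ j′ lt ei ej =
      cong (node a) (graftᵛ-parallel ss t u i j refl refl i′ j′ lt ei ej)

    graftᵛ-parallel : ∀ {n} (ss : Vec Tree n) t u i j {ws₁ ws₂ : Vec Tree n} →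
                      ws₁ ≡ graftᵛ ss i t → ws₂ ≡ graftᵛ ss j u →
                      (i′ : Fin (leavesᵛ ws₂)) (j′ : Fin (leavesᵛ ws₁)) → toℕ i ℕ.< toℕ j →
                      toℕ i′ ≡ toℕ i → suc (toℕ j′) ≡ toℕ j ℕ.+ leaves t →
                      graftᵛ ws₁ j′ u ≡ graftᵛ ws₂ i′ t
    graftᵛ-parallel (s ∷ ss) t u i j q₁ q₂ i′ j′ lt ei ej
      with view (leaves s) i | view (leaves s) j
    ... | left i₁ p | left j₁ q
      with refl ← trans q₁ (graft-left s ss i t i₁ p)
         | refl ← trans q₂ (graft-left s ss j u j₁ q)
      with i₁<j₁ ← subst₂< p q lt
      with i′₁ , ei′ ← leftOf (leaves (graft s j₁ u)) i′ (subst (ℕ._< _) (sym (trans ei p))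
             (<-composite (leaves-graft s j₁ u) i₁<j₁ (Finₚ.toℕ<n j₁)))
         | j′₁ , ej′ ← leftOf (leaves (graft s i₁ t)) j′ (shifted-< (trans ej (cong (ℕ._+ leaves t) q))
             (leaves-graft s i₁ t) (Finₚ.toℕ<n j₁)) = begin
      graftᵛ (graft s i₁ t ∷ ss) j′ u ≡⟨ graft-left _ ss j′ u j′₁ ej′ ⟩
      graft (graft s i₁ t) j′₁ u ∷ ss ≡⟨ cong (_∷ ss) (graft-parallel s t u i₁ j₁ refl refl i′₁ j′₁ i₁<j₁
                                           (trans (sym ei′) (trans ei p))
                                           (trans (cong suc (sym ej′)) (trans ej (cong (ℕ._+ leaves t) q)))) ⟩
      graft (graft s j₁ u) i′₁ t ∷ ss ≡⟨ graft-left _ ss i′ t i′₁ ei′ ⟨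
      graftᵛ (graft s j₁ u ∷ ss) i′ t ∎
      where
      open ≡-Reasoning
    ... | left i₁ p | right j₂ q
      with refl ← trans q₁ (graft-left s ss i t i₁ p)
         | refl ← trans q₂ (graft-right s ss j u j₂ q)
      with j′₂ , ej′ , ej₂ ← rightOf (leaves (graft s i₁ t)) j′ {j = toℕ j₂}
             (right-shift (leaves-graft s i₁ t) q ej) = begin
      graftᵛ (graft s i₁ t ∷ ss) j′ u ≡⟨ graft-right _ ss j′ u j′₂ ej′ ⟩
      graft s i₁ t ∷ graftᵛ ss j′₂ u  ≡⟨ cong (λ k → graft s i₁ t ∷ graftᵛ ss k u) (Finₚ.toℕ-injective ej₂) ⟩
      graft s i₁ t ∷ graftᵛ ss j₂ u   ≡⟨ graft-left s _ i′ t i₁ (trans ei p) ⟨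
      graftᵛ (s ∷ graftᵛ ss j₂ u) i′ t ∎
      where
      open ≡-Reasoning
    ... | right i₂ p | left j₁ q =
      contradiction (ℕₚ.<-trans (subst₂< p q lt) (Finₚ.toℕ<n j₁)) (ℕₚ.m+n≮m (leaves s) _)
    ... | right i₂ p | right j₂ q
      with refl ← trans q₁ (graft-right s ss i t i₂ p)
         | refl ← trans q₂ (graft-right s ss j u j₂ q)
      with i′₂ , ei′ , ei₂ ← rightOf (leaves s) i′ (trans ei p)
         | j′₂ , ej′ , _   ← rightOf (leaves s) j′ {j = ℕ.pred (toℕ j₂ ℕ.+ leaves t)}
                               (pred-shift (leaves s) (ℕₚ.≤-trans (s≤s z≤n) (cancel< (leaves s) p q lt)) (trans ej (cong (ℕ._+ leaves t) q)))
      = begin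
      graftᵛ (s ∷ graftᵛ ss i₂ t) j′ u  ≡⟨ graft-right s _ j′ u j′₂ ej′ ⟩
      s ∷ graftᵛ (graftᵛ ss i₂ t) j′₂ u ≡⟨ cong (s ∷_) (graftᵛ-parallel ss t u i₂ j₂ refl refl i′₂ j′₂
                                             (cancel< (leaves s) p q lt) ei₂
                                             (ℕₚ.+-cancelˡ-≡ (leaves s) _ _
                                               (trans (ℕₚ.+-suc (leaves s) _)
                                               (trans (cong suc (sym ej′))
                                               (trans ej (trans (cong (ℕ._+ leaves t) q)
                                               (ℕₚ.+-assoc (leaves s) _ _))))))) ⟩
      s ∷ graftᵛ (graftᵛ ss j₂ u) i′₂ t ≡⟨ graft-right s _ i′ t i′₂ ei′ ⟨
      graftᵛ (s ∷ graftᵛ ss j₂ u) i′ t  ∎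
      where
      open ≡-Reasoning

  treeOperad : SetOperad
  treeOperad = record
    { Object     = Tree
    ; arity      = leaves
    ; one        = leaf
    ; _∘[_]_     = graft
    ; arity-one  = refl
    ; arity-∘    = leaves-graft
    ; identityˡ  = λ _ _ → refl
    ; identityʳ  = graft-leaf
    ; sequential = λ s t u i j → graft-sequential s i t j u refl
    ; parallel   = λ s t u i j → graft-parallel s t u i j refl refl
    }

  open SetOperad treeOperad public using (Component; compose)

  generator : ∀ {k} → S k → Component k
  generator a = corolla a , leaves-corolla a

module Words {A : Set} {_∙_ : A → A → A} {ε : A} (isMonoid : IsMonoid _≡_ _∙_ ε) where

  open IsMonoid isMonoid using (assoc; identityˡ; identityʳ)

  substitute : (u : List⁺ A) → Fin (List⁺.length u) → List⁺ A → List⁺ A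
  substitute (x ∷ u)     zero    v = List⁺.map (x ∙_) v ⁺++ u
  substitute (x ∷ y ∷ u) (suc i) v = x ∷⁺ substitute (y ∷ u) i v

  sub : (u : List A) → Fin (List.length u) → List A → List A
  sub (x ∷ u) zero    v = List.map (x ∙_) v ++ u
  sub (x ∷ u) (suc i) v = x ∷ sub u i v

  toList-injective : {u v : List⁺ A} → toList u ≡ toList v → u ≡ v
  toList-injective refl = refl

  toList-substitute : ∀ u i v → toList (substitute u i v) ≡ sub (toList u) i (toList v)
  toList-substitute (x ∷ u)     zero    v = refl
  toList-substitute (x ∷ y ∷ u) (suc i) v = cong (x ∷_) (toList-substitute (y ∷ u) i v)

  length-sub : ∀ u i v → suc (List.length (sub u i v)) ≡ List.length u ℕ.+ List.length v
  length-sub (x ∷ u) zero v = cong suc (begin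
    List.length (List.map (x ∙_) v ++ u)             ≡⟨ Listₚ.length-++ (List.map (x ∙_) v) ⟩
    List.length (List.map (x ∙_) v) ℕ.+ List.length u ≡⟨ cong (ℕ._+ _) (Listₚ.length-map (x ∙_) v) ⟩
    List.length v ℕ.+ List.length u                  ≡⟨ ℕₚ.+-comm (List.length v) _ ⟩
    List.length u ℕ.+ List.length v                  ∎)
    where
    open ≡-Reasoning
  length-sub (x ∷ u) (suc i) v = cong suc (length-sub u i v)

  map-ε : ∀ v → List.map (ε ∙_) v ≡ v
  map-ε v = trans (Listₚ.map-cong identityˡ v) (Listₚ.map-id v)

  sub-identityʳ : ∀ u i → sub u i (ε ∷ []) ≡ u
  sub-identityʳ (x ∷ u) zero    = cong (_∷ u) (identityʳ x)
  sub-identityʳ (x ∷ u) (suc i) = cong (x ∷_) (sub-identityʳ u i)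

  -- Here and below, w is a composite word, kept abstract since the type of
  -- the position in it depends on it.
  sub-map-++ : ∀ x v u j z {w} → w ≡ List.map (x ∙_) v ++ u →
               (k : Fin (List.length w)) → toℕ k ≡ toℕ j →
               sub w k z ≡ List.map (x ∙_) (sub v j z) ++ u
  sub-map-++ x (y ∷ v) u zero z refl zero e = begin
    List.map ((x ∙ y) ∙_) z ++ List.map (x ∙_) v ++ u               ≡⟨ cong (_++ List.map (x ∙_) v ++ u)
                                                                       (trans (Listₚ.map-cong (assoc x y) z)
                                                                              (Listₚ.map-∘ z)) ⟩
    List.map (x ∙_) (List.map (y ∙_) z) ++ List.map (x ∙_) v ++ u   ≡⟨ Listₚ.++-assoc
                                                                       (List.map (x ∙_) (List.map (y ∙_) z)) _ u ⟨
    (List.map (x ∙_) (List.map (y ∙_) z) ++ List.map (x ∙_) v) ++ u ≡⟨ cong (_++ u)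
                                                                       (Listₚ.map-++ (x ∙_) (List.map (y ∙_) z) v) ⟨
    List.map (x ∙_) (List.map (y ∙_) z ++ v) ++ u                   ∎
    where
    open ≡-Reasoning
  sub-map-++ x (y ∷ v) u (suc j) z refl (suc k) e =
    cong (x ∙ y ∷_) (sub-map-++ x v u j z refl k (ℕₚ.suc-injective e))

  sub-++ʳ : ∀ p u j z {w} → w ≡ p ++ u → (k : Fin (List.length w)) →
            toℕ k ≡ List.length p ℕ.+ toℕ j → sub w k z ≡ p ++ sub u j z
  sub-++ʳ []      u j z refl k       e = cong (λ k → sub u k z) (Finₚ.toℕ-injective e)
  sub-++ʳ (x ∷ p) u j z refl (suc k) e = cong (x ∷_) (sub-++ʳ p u j z refl k (ℕₚ.suc-injective e))

  sub-sequential : ∀ u i v j z {w} → w ≡ sub u i v → (k : Fin (List.length w)) →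
                   toℕ k ≡ toℕ i ℕ.+ toℕ j → sub w k z ≡ sub u i (sub v j z)
  sub-sequential (x ∷ u) zero    v j z eq   k       e = sub-map-++ x v u j z eq k e
  sub-sequential (x ∷ u) (suc i) v j z refl (suc k) e =
    cong (x ∷_) (sub-sequential u i v j z refl k (ℕₚ.suc-injective e))

  sub-parallel : ∀ u v z i j {w₁ w₂} → w₁ ≡ sub u i v → w₂ ≡ sub u j z →
                 (i′ : Fin (List.length w₂)) (j′ : Fin (List.length w₁)) →
                 toℕ i ℕ.< toℕ j → toℕ i′ ≡ toℕ i → suc (toℕ j′) ≡ toℕ j ℕ.+ List.length v →
                 sub w₁ j′ z ≡ sub w₂ i′ v
  sub-parallel (x ∷ u) v z zero (suc j) eq refl zero j′ lt _ ej =
    sub-++ʳ (List.map (x ∙_) v) u j z eq j′ (begin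
      toℕ j′                                   ≡⟨ ℕₚ.suc-injective ej ⟩
      toℕ j ℕ.+ List.length v                  ≡⟨ ℕₚ.+-comm (toℕ j) _ ⟩
      List.length v ℕ.+ toℕ j                  ≡⟨ cong (ℕ._+ toℕ j) (Listₚ.length-map (x ∙_) v) ⟨
      List.length (List.map (x ∙_) v) ℕ.+ toℕ j ∎)
    where
    open ≡-Reasoning
  sub-parallel (x ∷ u) v z (suc i) (suc j) refl refl (suc i′) (suc j′) (s≤s lt) ei ej =
    cong (x ∷_) (sub-parallel u v z i j refl refl i′ j′ lt (ℕₚ.suc-injective ei) (ℕₚ.suc-injective ej))
  sub-parallel (x ∷ u) v z (suc i) (suc j) refl refl (suc i′) zero (s≤s lt) ei ej =
    contradiction lt (subst (λ n → ¬ (toℕ i ℕ.< n))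
      (sym (ℕₚ.m+n≡0⇒m≡0 (toℕ j) (sym (ℕₚ.suc-injective ej)))) ℕₚ.n≮0)

  wordOperad : SetOperad
  wordOperad = record
    { Object     = List⁺ A
    ; arity      = List⁺.length
    ; one        = ε ∷ []
    ; _∘[_]_     = substitute
    ; arity-one  = refl
    ; arity-∘    = λ u i v → trans (cong (suc ∘ List.length) (toList-substitute u i v))
                                   (length-sub (toList u) i (toList v))
    ; identityˡ  = λ { zero v → toList-injective
                         (trans (Listₚ.++-identityʳ _) (map-ε (toList v))) }
    ; identityʳ  = λ u i → toList-injective
                     (trans (toList-substitute u i (ε ∷ [])) (sub-identityʳ (toList u) i))
    ; sequential = λ u v z i j k e → toList-injective (begin
        toList (substitute (substitute u i v) k z)         ≡⟨ toList-substitute (substitute u i v) k z ⟩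
        sub (toList (substitute u i v)) k (toList z)       ≡⟨ sub-sequential (toList u) i (toList v) j (toList z)
                                                                (toList-substitute u i v) k e ⟩
        sub (toList u) i (sub (toList v) j (toList z))     ≡⟨ cong (sub (toList u) i) (toList-substitute v j z) ⟨
        sub (toList u) i (toList (substitute v j z))       ≡⟨ toList-substitute u i (substitute v j z) ⟨
        toList (substitute u i (substitute v j z))         ∎)
    ; parallel   = λ u v z i j i′ j′ lt ei ej → toList-injective (begin
        toList (substitute (substitute u i v) j′ z)        ≡⟨ toList-substitute (substitute u i v) j′ z ⟩
        sub (toList (substitute u i v)) j′ (toList z)      ≡⟨ sub-parallel (toList u) (toList v) (toList z) i j
                                                                (toList-substitute u i v) (toList-substitute u j z)
                                                                i′ j′ lt ei ej ⟩
        sub (toList (substitute u j z)) i′ (toList v)      ≡⟨ toList-substitute (substitute u j z) i′ v ⟨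
        toList (substitute (substitute u j z) i′ v)        ∎)
    }
    where
    open ≡-Reasoning

module Linear {c ℓ : Level} (𝕂 : CommutativeRing c ℓ) where

  open CommutativeRing 𝕂 using (ring; Carrier; 1#; 0#; -_)
    renaming (_+_ to _+ᴷ_; _*_ to _*ᴷ_; _≈_ to _≈ᴷ_; refl to reflᴷ)

  -- Same conventions as for SetOperad.  The arity of a composite is given
  -- up to an explicit equation, and the axioms hold for all such equations.

  record Operad (a b : Level) : Set (c ⊔ ℓ ⊔ lsuc (a ⊔ b)) where
    field
      space : ℕ → LeftModule ring a b

    module Space {n : ℕ} = LeftModule (space n)
    open Space using (_≈ᴹ_; _+ᴹ_; _*ₗ_)

    Element : ℕ → Set a
    Element n = LeftModule.Carrierᴹ (space n)

    field
      one     : Element 1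
      compose : ∀ {m n p} → suc p ≡ m ℕ.+ n → Element m → Fin m → Element n → Element p

      compose-cong : ∀ {m n p} (e : suc p ≡ m ℕ.+ n) i {x x′ : Element m} {y y′ : Element n} →
                     x ≈ᴹ x′ → y ≈ᴹ y′ → compose e x i y ≈ᴹ compose e x′ i y′
      +-linearˡ    : ∀ {m n p} (e : suc p ≡ m ℕ.+ n) i (x x′ : Element m) (y : Element n) →
                     compose e (x +ᴹ x′) i y ≈ᴹ compose e x i y +ᴹ compose e x′ i y
      +-linearʳ    : ∀ {m n p} (e : suc p ≡ m ℕ.+ n) i (x : Element m) (y y′ : Element n) →
                     compose e x i (y +ᴹ y′) ≈ᴹ compose e x i y +ᴹ compose e x i y′
      *-linearˡ    : ∀ {m n p} (e : suc p ≡ m ℕ.+ n) i r (x : Element m) (y : Element n) →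
                     compose e (r *ₗ x) i y ≈ᴹ r *ₗ compose e x i y
      *-linearʳ    : ∀ {m n p} (e : suc p ≡ m ℕ.+ n) i r (x : Element m) (y : Element n) →
                     compose e x i (r *ₗ y) ≈ᴹ r *ₗ compose e x i y

      identityˡ  : ∀ {n} (e : suc n ≡ 1 ℕ.+ n) i (x : Element n) → compose e one i x ≈ᴹ x
      identityʳ  : ∀ {n} (e : suc n ≡ n ℕ.+ 1) i (x : Element n) → compose e x i one ≈ᴹ x

      sequential : ∀ {l m n lm mn lmn}
                   (e₁ : suc lm ≡ l ℕ.+ m) (e₂ : suc lmn ≡ lm ℕ.+ n)
                   (e₃ : suc mn ≡ m ℕ.+ n) (e₄ : suc lmn ≡ l ℕ.+ mn)
                   (x : Element l) (y : Element m) (z : Element n) i j k →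
                   toℕ k ≡ toℕ i ℕ.+ toℕ j →
                   compose e₂ (compose e₁ x i y) k z ≈ᴹ compose e₄ x i (compose e₃ y j z)
      parallel   : ∀ {l m n lm ln lmn}
                   (e₁ : suc lm ≡ l ℕ.+ m) (e₂ : suc lmn ≡ lm ℕ.+ n)
                   (e₃ : suc ln ≡ l ℕ.+ n) (e₄ : suc lmn ≡ ln ℕ.+ m)
                   (x : Element l) (y : Element m) (z : Element n) i j i′ j′ →
                   toℕ i ℕ.< toℕ j → toℕ i′ ≡ toℕ i → suc (toℕ j′) ≡ toℕ j ℕ.+ m →
                   compose e₂ (compose e₁ x i y) j′ z ≈ᴹ compose e₄ (compose e₃ x j z) i′ y

  record _≅_ {a b a′ b′ : Level} (𝒪 : Operad a b) (𝒫 : Operad a′ b′) :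
             Set (c ⊔ ℓ ⊔ a ⊔ b ⊔ a′ ⊔ b′) where
    module 𝒪 = Operad 𝒪
    module 𝒫 = Operad 𝒫
    open 𝒫.Space using (_≈ᴹ_)
    field
      ⟦_⟧            : ∀ {n} → 𝒪.Element n → 𝒫.Element n
      isIsomorphism : ∀ {n} → IsLeftModuleIsomorphism
                        (LeftModule.rawLeftModule (𝒪.space n)) (LeftModule.rawLeftModule (𝒫.space n))
                        (⟦_⟧ {n})
      one-homo      : ⟦ 𝒪.one ⟧ ≈ᴹ 𝒫.one
      compose-homo  : ∀ {m n p} (e : suc p ≡ m ℕ.+ n) (x : 𝒪.Element m) i (y : 𝒪.Element n) →
                      ⟦ 𝒪.compose e x i y ⟧ ≈ᴹ 𝒫.compose e ⟦ x ⟧ i ⟦ y ⟧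

  -- The vector space with a given basis: formal linear combinations, modulo
  -- the least congruence making them a module.

  infixl 6 _⊕_ _⊖_
  infixr 7 _⊙_

  data Combination (B : Set) : Set c where
    ⟨_⟩ : B → Combination B
    𝟎   : Combination B
    _⊕_ : Combination B → Combination B → Combination B
    _⊙_ : Carrier → Combination B → Combination B

  _⊖_ : {B : Set} → Combination B → Combination B → Combination B
  x ⊖ y = x ⊕ (- 1#) ⊙ y

  infix 4 _≋_

  data _≋_ {B : Set} : Combination B → Combination B → Set (c ⊔ ℓ) where
    ≋-refl  : ∀ {x} → x ≋ x
    ≋-sym   : ∀ {x y} → x ≋ y → y ≋ x
    ≋-trans : ∀ {x y z} → x ≋ y → y ≋ z → x ≋ z

    ⊕-cong      : ∀ {x x′ y y′} → x ≋ x′ → y ≋ y′ → x ⊕ y ≋ x′ ⊕ y′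
    ⊕-assoc     : ∀ x y z → (x ⊕ y) ⊕ z ≋ x ⊕ (y ⊕ z)
    ⊕-comm      : ∀ x y → x ⊕ y ≋ y ⊕ x
    ⊕-identityˡ : ∀ x → 𝟎 ⊕ x ≋ x

    ⊙-cong      : ∀ {r r′ x x′} → r ≈ᴷ r′ → x ≋ x′ → r ⊙ x ≋ r′ ⊙ x′
    ⊙-zeroˡ     : ∀ x → 0# ⊙ x ≋ 𝟎
    ⊙-identityˡ : ∀ x → 1# ⊙ x ≋ x
    ⊙-assoc     : ∀ r r′ x → (r *ᴷ r′) ⊙ x ≋ r ⊙ (r′ ⊙ x)
    ⊙-distribʳ  : ∀ x r r′ → (r +ᴷ r′) ⊙ x ≋ r ⊙ x ⊕ r′ ⊙ x
    ⊙-distribˡ  : ∀ r x y → r ⊙ (x ⊕ y) ≋ r ⊙ x ⊕ r ⊙ y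

  ⊙-zeroʳ : {B : Set} → ∀ r → r ⊙ 𝟎 ≋ 𝟎 {B}
  ⊙-zeroʳ r =
    ≋-trans (⊙-cong reflᴷ (≋-sym (⊙-zeroˡ 𝟎)))
    (≋-trans (≋-sym (⊙-assoc r 0# 𝟎))
    (≋-trans (⊙-cong (CommutativeRing.zeroʳ 𝕂 r) ≋-refl) (⊙-zeroˡ 𝟎)))

  ⊖-inverse : {B : Set} (x : Combination B) → x ⊖ x ≋ 𝟎
  ⊖-inverse x =
    ≋-trans (⊕-cong (≋-sym (⊙-identityˡ x)) ≋-refl)
    (≋-trans (≋-sym (⊙-distribʳ x 1# (- 1#)))
    (≋-trans (⊙-cong (CommutativeRing.-‿inverseʳ 𝕂 1#) ≋-refl) (⊙-zeroˡ x)))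

  combinations : Set → LeftModule ring c (c ⊔ ℓ)
  combinations B = record
    { Carrierᴹ = Combination B
    ; _≈ᴹ_     = _≋_
    ; _+ᴹ_     = _⊕_
    ; _*ₗ_     = _⊙_
    ; 0ᴹ       = 𝟎
    ; -ᴹ_      = (- 1#) ⊙_
    ; isLeftModule = record
      { isLeftSemimodule = record
        { +ᴹ-isCommutativeMonoid = record
          { isMonoid = record
            { isSemigroup = record
              { isMagma = record
                { isEquivalence = record { refl = ≋-refl ; sym = ≋-sym ; trans = ≋-trans }
                ; ∙-cong = ⊕-cong
                }
              ; assoc = ⊕-assoc
              }
            ; identity = ⊕-identityˡ , λ x → ≋-trans (⊕-comm x 𝟎) (⊕-identityˡ x)
            }
          ; comm = ⊕-comm
          }
        ; isPreleftSemimodule = record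
          { *ₗ-cong      = ⊙-cong
          ; *ₗ-zeroˡ     = ⊙-zeroˡ
          ; *ₗ-distribʳ  = ⊙-distribʳ
          ; *ₗ-identityˡ = ⊙-identityˡ
          ; *ₗ-assoc     = ⊙-assoc
          ; *ₗ-zeroʳ     = ⊙-zeroʳ
          ; *ₗ-distribˡ  = ⊙-distribˡ
          }
        }
      ; -ᴹ‿cong    = ⊙-cong reflᴷ
      ; -ᴹ‿inverse = (λ x → ≋-trans (⊕-comm _ x) (⊖-inverse x)) , ⊖-inverse
      }
    }

  extend : {B C : Set} → (B → Combination C) → Combination B → Combination C
  extend f ⟨ b ⟩   = f b
  extend f 𝟎       = 𝟎
  extend f (x ⊕ y) = extend f x ⊕ extend f y
  extend f (r ⊙ x) = r ⊙ extend f x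

  bilinear : {B C D : Set} → (B → C → D) → Combination B → Combination C → Combination D
  bilinear f x y = extend (λ b → extend (λ b′ → ⟨ f b b′ ⟩) y) x

  extend-cong : {B C : Set} (f : B → Combination C) {x y : Combination B} →
                x ≋ y → extend f x ≋ extend f y
  extend-cong f ≋-refl             = ≋-refl
  extend-cong f (≋-sym p)          = ≋-sym (extend-cong f p)
  extend-cong f (≋-trans p q)      = ≋-trans (extend-cong f p) (extend-cong f q)
  extend-cong f (⊕-cong p q)       = ⊕-cong (extend-cong f p) (extend-cong f q)
  extend-cong f (⊕-assoc x y z)    = ⊕-assoc _ _ _
  extend-cong f (⊕-comm x y)       = ⊕-comm _ _
  extend-cong f (⊕-identityˡ x)    = ⊕-identityˡ _
  extend-cong f (⊙-cong p q)       = ⊙-cong p (extend-cong f q)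
  extend-cong f (⊙-zeroˡ x)        = ⊙-zeroˡ _
  extend-cong f (⊙-identityˡ x)    = ⊙-identityˡ _
  extend-cong f (⊙-assoc r r′ x)   = ⊙-assoc r r′ _
  extend-cong f (⊙-distribʳ x r s) = ⊙-distribʳ _ r s
  extend-cong f (⊙-distribˡ r x y) = ⊙-distribˡ r _ _

  extend-ext : {B C : Set} {f g : B → Combination C} → (∀ b → f b ≋ g b) →
               ∀ x → extend f x ≋ extend g x
  extend-ext p ⟨ b ⟩   = p b
  extend-ext p 𝟎       = ≋-refl
  extend-ext p (x ⊕ y) = ⊕-cong (extend-ext p x) (extend-ext p y)
  extend-ext p (r ⊙ x) = ⊙-cong reflᴷ (extend-ext p x)

  extend-extend : {B C D : Set} (g : C → Combination D) (f : B → Combination C) →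
                  ∀ x → extend g (extend f x) ≋ extend (extend g ∘ f) x
  extend-extend g f ⟨ b ⟩   = ≋-refl
  extend-extend g f 𝟎       = ≋-refl
  extend-extend g f (x ⊕ y) = ⊕-cong (extend-extend g f x) (extend-extend g f y)
  extend-extend g f (r ⊙ x) = ⊙-cong reflᴷ (extend-extend g f x)

  extend-𝟎 : {B C : Set} (x : Combination B) → extend (λ _ → 𝟎 {C}) x ≋ 𝟎
  extend-𝟎 ⟨ b ⟩   = ≋-refl
  extend-𝟎 𝟎       = ≋-refl
  extend-𝟎 (x ⊕ y) = ≋-trans (⊕-cong (extend-𝟎 x) (extend-𝟎 y)) (⊕-identityˡ 𝟎)
  extend-𝟎 (r ⊙ x) = ≋-trans (⊙-cong reflᴷ (extend-𝟎 x)) (⊙-zeroʳ r)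

  extend-⊕ : {B C : Set} (f g : B → Combination C) →
             ∀ x → extend (λ b → f b ⊕ g b) x ≋ extend f x ⊕ extend g x
  extend-⊕ f g ⟨ b ⟩   = ≋-refl
  extend-⊕ f g 𝟎       = ≋-sym (⊕-identityˡ 𝟎)
  extend-⊕ {C = C} f g (x ⊕ y) = ≋-trans (⊕-cong (extend-⊕ f g x) (extend-⊕ f g y))
    (CommutativeSemigroupProperties.interchange commutativeSemigroup _ _ _ _)
    where
    open LeftModule (combinations C) using (+ᴹ-commutativeMonoid)
    open CommutativeMonoid +ᴹ-commutativeMonoid using (commutativeSemigroup)
  extend-⊕ f g (r ⊙ x) = ≋-trans (⊙-cong reflᴷ (extend-⊕ f g x)) (⊙-distribˡ r _ _)

  extend-⊙ : {B C : Set} (r : Carrier) (f : B → Combination C) →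
             ∀ x → extend (λ b → r ⊙ f b) x ≋ r ⊙ extend f x
  extend-⊙ r f ⟨ b ⟩   = ≋-refl
  extend-⊙ r f 𝟎       = ≋-sym (⊙-zeroʳ r)
  extend-⊙ r f (x ⊕ y) = ≋-trans (⊕-cong (extend-⊙ r f x) (extend-⊙ r f y)) (≋-sym (⊙-distribˡ r _ _))
  extend-⊙ r f (s ⊙ x) =
    ≋-trans (⊙-cong reflᴷ (extend-⊙ r f x))
    (≋-trans (≋-sym (⊙-assoc s r _))
    (≋-trans (⊙-cong (CommutativeRing.*-comm 𝕂 s r) ≋-refl) (⊙-assoc r s _)))

  extend-⟨⟩ : {B : Set} (x : Combination B) → extend ⟨_⟩ x ≋ x
  extend-⟨⟩ ⟨ b ⟩   = ≋-refl
  extend-⟨⟩ 𝟎       = ≋-refl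
  extend-⟨⟩ (x ⊕ y) = ⊕-cong (extend-⟨⟩ x) (extend-⟨⟩ y)
  extend-⟨⟩ (r ⊙ x) = ⊙-cong reflᴷ (extend-⟨⟩ x)

  extend-swap : {B C D : Set} (f : B → C → Combination D) → ∀ x y →
                extend (λ b → extend (f b) y) x ≋ extend (λ d → extend (λ b → f b d) x) y
  extend-swap f ⟨ b ⟩    y = ≋-refl
  extend-swap f 𝟎        y = ≋-sym (extend-𝟎 y)
  extend-swap f (x ⊕ x′) y =
    ≋-trans (⊕-cong (extend-swap f x y) (extend-swap f x′ y)) (≋-sym (extend-⊕ _ _ y))
  extend-swap f (r ⊙ x)  y =
    ≋-trans (⊙-cong reflᴷ (extend-swap f x y)) (≋-sym (extend-⊙ r _ y))

  linearize : SetOperad → Operad c (c ⊔ ℓ)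
  linearize P = record
    { space        = λ n → combinations (Component n)
    ; one          = ⟨ one , arity-one ⟩
    ; compose      = comp
    ; compose-cong = λ e i {x′ = x′} p q →
        ≋-trans (extend-cong _ p) (extend-ext (λ _ → extend-cong _ q) x′)
    ; +-linearˡ    = λ _ _ _ _ _ → ≋-refl
    ; +-linearʳ    = λ _ _ x _ _ → extend-⊕ _ _ x
    ; *-linearˡ    = λ _ _ _ _ _ → ≋-refl
    ; *-linearʳ    = λ _ _ r x _ → extend-⊙ r _ x
    ; identityˡ    = λ e i y → ≋-trans (extend-ext (λ b → ≡⇒≋ (P-identityˡ e i b)) y) (extend-⟨⟩ y)
    ; identityʳ    = λ e i x → ≋-trans (extend-ext (λ b → ≡⇒≋ (P-identityʳ e i b)) x) (extend-⟨⟩ x)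
    ; sequential   = λ e₁ e₂ e₃ e₄ x y z i j k eq →
        ≋-trans (expandˡ e₁ e₂ i k x y z)
        (≋-trans (extend-ext (λ a → extend-ext (λ b → extend-ext (λ d →
                   ≡⇒≋ (P-sequential e₁ e₂ e₃ e₄ a b d i j k eq)) z) y) x)
        (≋-sym (extend-ext (λ a → ≋-trans (extend-extend _ _ y)
                                  (extend-ext (λ b → extend-extend _ _ z) y)) x)))
    ; parallel     = λ e₁ e₂ e₃ e₄ x y z i j i′ j′ lt ei ej →
        ≋-trans (expandˡ e₁ e₂ i j′ x y z)
        (≋-trans (extend-ext (λ a → extend-ext (λ b → extend-ext (λ d →
                   ≡⇒≋ (P-parallel e₁ e₂ e₃ e₄ a b d i j i′ j′ lt ei ej)) z) y) x)
        (≋-trans (extend-ext (λ a → extend-swap _ y z) x)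
        (≋-sym (expandˡ e₃ e₄ j i′ x z y))))
    }
    where
    open SetOperad P

    comp : ∀ {m n p} → suc p ≡ m ℕ.+ n → Combination (Component m) → Fin m →
           Combination (Component n) → Combination (Component p)
    comp e x i y = bilinear (λ a b → compose e a i b) x y

    ≡⇒≋ : ∀ {n} {a b : Component n} → a ≡ b → ⟨ a ⟩ ≋ ⟨ b ⟩
    ≡⇒≋ refl = ≋-refl

    expandˡ : ∀ {l m n lm lmn} (e₁ : suc lm ≡ l ℕ.+ m) (e₂ : suc lmn ≡ lm ℕ.+ n)
              (i : Fin l) (k : Fin lm) (x : Combination (Component l))
              (y : Combination (Component m)) (z : Combination (Component n)) →
              comp e₂ (comp e₁ x i y) k z ≋
              extend (λ a → extend (λ b → extend (λ d →
                ⟨ compose e₂ (compose e₁ a i b) k d ⟩) z) y) x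
    expandˡ e₁ e₂ i k x y z =
      ≋-trans (extend-extend _ _ x) (extend-ext (λ a → extend-extend _ _ y) x)

    P-identityˡ : ∀ {n} (e : suc n ≡ 1 ℕ.+ n) i (y : Component n) →
                  compose e (one , arity-one) i y ≡ y
    P-identityˡ e i (y , refl) = Component-≡ (lemma arity-one i)
      where
      lemma : ∀ {m} (q : arity one ≡ m) (i : Fin m) {e : suc (arity y) ≡ m ℕ.+ arity y} →
              proj₁ (compose e (one , q) i (y , refl)) ≡ y
      lemma refl i = identityˡ i y

    P-identityʳ : ∀ {n} (e : suc n ≡ n ℕ.+ 1) i (x : Component n) →
                  compose e x i (one , arity-one) ≡ x
    P-identityʳ e i (x , refl) = Component-≡ (lemma arity-one)
      where
      lemma : ∀ {m} (q : arity one ≡ m) {e : suc (arity x) ≡ arity x ℕ.+ m} →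
              proj₁ (compose e (x , refl) i (one , q)) ≡ x
      lemma refl = identityʳ x i

    proj₁-compose : ∀ {m n p} (e : suc p ≡ m ℕ.+ n) (x : Component m) i (y : Component n)
                    (i′ : Fin (arity (proj₁ x))) → toℕ i′ ≡ toℕ i →
                    proj₁ (compose e x i y) ≡ proj₁ x ∘[ i′ ] proj₁ y
    proj₁-compose e (x , refl) i (y , refl) i′ q =
      cong (λ i → x ∘[ i ] y) (sym (Finₚ.toℕ-injective q))

    position : ∀ {n} (x : Component n) → Fin n → Fin (arity (proj₁ x))
    position (x , refl) i = i

    toℕ-position : ∀ {n} (x : Component n) i → toℕ (position x i) ≡ toℕ i
    toℕ-position (x , refl) i = refl

    P-sequential : ∀ {l m n lm mn lmn}
                   (e₁ : suc lm ≡ l ℕ.+ m) (e₂ : suc lmn ≡ lm ℕ.+ n)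
                   (e₃ : suc mn ≡ m ℕ.+ n) (e₄ : suc lmn ≡ l ℕ.+ mn)
                   (x : Component l) (y : Component m) (z : Component n) i j k →
                   toℕ k ≡ toℕ i ℕ.+ toℕ j →
                   compose e₂ (compose e₁ x i y) k z ≡ compose e₄ x i (compose e₃ y j z)
    P-sequential e₁ e₂ e₃ e₄ x@(_ , refl) y@(_ , refl) z@(_ , refl) i j k eq = Component-≡ (
      trans (proj₁-compose e₂ w k z (position w k) (toℕ-position w k))
      (trans (sequential _ _ _ i j (position w k) (trans (toℕ-position w k) eq))
      (sym (proj₁-compose e₄ x i (compose e₃ y j z) i refl))))
      where w = compose e₁ x i y

    P-parallel : ∀ {l m n lm ln lmn}
                 (e₁ : suc lm ≡ l ℕ.+ m) (e₂ : suc lmn ≡ lm ℕ.+ n)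
                 (e₃ : suc ln ≡ l ℕ.+ n) (e₄ : suc lmn ≡ ln ℕ.+ m)
                 (x : Component l) (y : Component m) (z : Component n) i j i′ j′ →
                 toℕ i ℕ.< toℕ j → toℕ i′ ≡ toℕ i → suc (toℕ j′) ≡ toℕ j ℕ.+ m →
                 compose e₂ (compose e₁ x i y) j′ z ≡ compose e₄ (compose e₃ x j z) i′ y
    P-parallel e₁ e₂ e₃ e₄ x@(_ , refl) y@(_ , refl) z@(_ , refl) i j i′ j′ lt ei ej = Component-≡ (
      trans (proj₁-compose e₂ w₁ j′ z (position w₁ j′) (toℕ-position w₁ j′))
      (trans (parallel _ _ _ i j (position w₂ i′) (position w₁ j′) lt
               (trans (toℕ-position w₂ i′) ei) (trans (cong suc (toℕ-position w₁ j′)) ej))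
      (sym (proj₁-compose e₄ w₂ i′ y (position w₂ i′) (toℕ-position w₂ i′)))))
      where w₁ = compose e₁ x i y
            w₂ = compose e₃ x j z

  module _ {a b : Level} (𝒪 : Operad a b) where
    open Operad 𝒪
    open Space using (_≈ᴹ_; _+ᴹ_; _*ₗ_; 0ᴹ; -ᴹ_)

    data Generated {g : Level} (G : ∀ {n} → Pred (Element n) g) :
                   ∀ {n} → Pred (Element n) (c ⊔ a ⊔ b ⊔ g) where
      gen       : ∀ {n} {x : Element n} → G x → Generated G x
      one∈      : Generated G one
      compose∈  : ∀ {m n p} (e : suc p ≡ m ℕ.+ n) {x : Element m} i {y : Element n} →
                  Generated G x → Generated G y → Generated G (compose e x i y)
      0∈        : ∀ {n} → Generated G (0ᴹ {n})
      +∈        : ∀ {n} {x y : Element n} → Generated G x → Generated G y → Generated G (x +ᴹ y)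
      *∈        : ∀ {n} r {x : Element n} → Generated G x → Generated G (r *ₗ x)
      resp∈     : ∀ {n} {x y : Element n} → x ≈ᴹ y → Generated G x → Generated G y

    data Ideal {g : Level} (R : ∀ {n} → Pred (Element n) g) :
               ∀ {n} → Pred (Element n) (c ⊔ a ⊔ b ⊔ g) where
      gen       : ∀ {n} {x : Element n} → R x → Ideal R x
      composeˡ∈ : ∀ {m n p} (e : suc p ≡ m ℕ.+ n) {x : Element m} i (y : Element n) →
                  Ideal R x → Ideal R (compose e x i y)
      composeʳ∈ : ∀ {m n p} (e : suc p ≡ m ℕ.+ n) (x : Element m) i {y : Element n} →
                  Ideal R y → Ideal R (compose e x i y)
      0∈        : ∀ {n} → Ideal R (0ᴹ {n})
      +∈        : ∀ {n} {x y : Element n} → Ideal R x → Ideal R y → Ideal R (x +ᴹ y)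
      *∈        : ∀ {n} r {x : Element n} → Ideal R x → Ideal R (r *ₗ x)
      resp∈     : ∀ {n} {x y : Element n} → x ≈ᴹ y → Ideal R x → Ideal R y

  module _ {a b : Level} (M : LeftModule ring a b) where
    open LeftModule M
    open SetoidReasoning ≈ᴹ-setoid
    open GroupProperties +ᴹ-group using (inverseˡ-unique)
    open AbelianGroupProperties +ᴹ-abelianGroup using (⁻¹-∙-comm)
    open CommutativeMonoid +ᴹ-commutativeMonoid using (commutativeSemigroup)
    open CommutativeSemigroupProperties commutativeSemigroup using (interchange)

    *-neg : ∀ r x → r *ₗ (-ᴹ x) ≈ᴹ -ᴹ (r *ₗ x)
    *-neg r x = inverseˡ-unique _ _ (begin
      r *ₗ (-ᴹ x) +ᴹ r *ₗ x ≈⟨ *ₗ-distribˡ r (-ᴹ x) x ⟨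
      r *ₗ (-ᴹ x +ᴹ x)      ≈⟨ *ₗ-cong reflᴷ (-ᴹ‿inverseˡ x) ⟩
      r *ₗ 0ᴹ               ≈⟨ *ₗ-zeroʳ r ⟩
      0ᴹ                    ∎)

    neg≈ : ∀ x → (- 1#) *ₗ x ≈ᴹ -ᴹ x
    neg≈ x = inverseˡ-unique _ _ (begin
      (- 1#) *ₗ x +ᴹ x       ≈⟨ +ᴹ-cong ≈ᴹ-refl (*ₗ-identityˡ x) ⟨
      (- 1#) *ₗ x +ᴹ 1# *ₗ x ≈⟨ *ₗ-distribʳ x (- 1#) 1# ⟨
      (- 1# +ᴷ 1#) *ₗ x      ≈⟨ *ₗ-cong (CommutativeRing.-‿inverseˡ 𝕂 1#) ≈ᴹ-refl ⟩
      0# *ₗ x                ≈⟨ *ₗ-zeroˡ x ⟩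
      0ᴹ                     ∎)

    neg-diff : ∀ x y → (- 1#) *ₗ (x +ᴹ -ᴹ y) ≈ᴹ y +ᴹ -ᴹ x
    neg-diff x y = begin
      (- 1#) *ₗ (x +ᴹ -ᴹ y)               ≈⟨ *ₗ-distribˡ (- 1#) x (-ᴹ y) ⟩
      (- 1#) *ₗ x +ᴹ (- 1#) *ₗ (-ᴹ y)     ≈⟨ +ᴹ-cong (neg≈ x) (neg≈ (-ᴹ y)) ⟩
      -ᴹ x +ᴹ -ᴹ (-ᴹ y)                   ≈⟨ +ᴹ-cong ≈ᴹ-refl (GroupProperties.⁻¹-involutive +ᴹ-group y) ⟩
      -ᴹ x +ᴹ y                           ≈⟨ +ᴹ-comm _ _ ⟩
      y +ᴹ -ᴹ x                           ∎

    diff-trans : ∀ x y z → (x +ᴹ -ᴹ y) +ᴹ (y +ᴹ -ᴹ z) ≈ᴹ x +ᴹ -ᴹ z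
    diff-trans x y z = begin
      (x +ᴹ -ᴹ y) +ᴹ (y +ᴹ -ᴹ z) ≈⟨ +ᴹ-assoc _ _ _ ⟩
      x +ᴹ (-ᴹ y +ᴹ (y +ᴹ -ᴹ z)) ≈⟨ +ᴹ-cong ≈ᴹ-refl (+ᴹ-assoc _ _ _) ⟨
      x +ᴹ ((-ᴹ y +ᴹ y) +ᴹ -ᴹ z) ≈⟨ +ᴹ-cong ≈ᴹ-refl (+ᴹ-cong (-ᴹ‿inverseˡ y) ≈ᴹ-refl) ⟩
      x +ᴹ (0ᴹ +ᴹ -ᴹ z)          ≈⟨ +ᴹ-cong ≈ᴹ-refl (+ᴹ-identityˡ _) ⟩
      x +ᴹ -ᴹ z                  ∎

    diff-+ : ∀ x x′ y y′ → (x +ᴹ -ᴹ x′) +ᴹ (y +ᴹ -ᴹ y′) ≈ᴹ (x +ᴹ y) +ᴹ -ᴹ (x′ +ᴹ y′)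
    diff-+ x x′ y y′ = begin
      (x +ᴹ -ᴹ x′) +ᴹ (y +ᴹ -ᴹ y′) ≈⟨ interchange _ _ _ _ ⟩
      (x +ᴹ y) +ᴹ (-ᴹ x′ +ᴹ -ᴹ y′) ≈⟨ +ᴹ-cong ≈ᴹ-refl (⁻¹-∙-comm x′ y′) ⟩
      (x +ᴹ y) +ᴹ -ᴹ (x′ +ᴹ y′)    ∎

    diff-* : ∀ r x y → r *ₗ (x +ᴹ -ᴹ y) ≈ᴹ r *ₗ x +ᴹ -ᴹ (r *ₗ y)
    diff-* r x y = begin
      r *ₗ (x +ᴹ -ᴹ y)        ≈⟨ *ₗ-distribˡ r x (-ᴹ y) ⟩
      r *ₗ x +ᴹ r *ₗ (-ᴹ y)   ≈⟨ +ᴹ-cong ≈ᴹ-refl (*-neg r y) ⟩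
      r *ₗ x +ᴹ -ᴹ (r *ₗ y)   ∎

    ≈⇒diff : ∀ {x y} → x ≈ᴹ y → 0ᴹ ≈ᴹ x +ᴹ -ᴹ y
    ≈⇒diff {x} {y} p = begin
      0ᴹ         ≈⟨ -ᴹ‿inverseʳ y ⟨
      y +ᴹ -ᴹ y  ≈⟨ +ᴹ-cong p ≈ᴹ-refl ⟨
      x +ᴹ -ᴹ y  ∎

  suboperad : ∀ {a b g} (𝒪 : Operad a b) → (∀ {n} → Pred (Operad.Element 𝒪 n) g) →
              Operad (c ⊔ a ⊔ b ⊔ g) b
  suboperad 𝒪 G = record
    { space        = λ n → record
      { Carrierᴹ = Σ[ x ∈ Element n ] Generated 𝒪 G x
      ; _≈ᴹ_     = λ x y → proj₁ x ≈ᴹ proj₁ y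
      ; _+ᴹ_     = λ x y → proj₁ x +ᴹ proj₁ y , +∈ (proj₂ x) (proj₂ y)
      ; _*ₗ_     = λ r x → r *ₗ proj₁ x , *∈ r (proj₂ x)
      ; 0ᴹ       = 0ᴹ , 0∈
      ; -ᴹ_      = λ x → -ᴹ (proj₁ x) , resp∈ (neg≈ (space n) (proj₁ x)) (*∈ (- 1#) (proj₂ x))
      ; isLeftModule = record
        { isLeftSemimodule = record
          { +ᴹ-isCommutativeMonoid = record
            { isMonoid = record
              { isSemigroup = record
                { isMagma = record
                  { isEquivalence = record { refl = ≈ᴹ-refl ; sym = ≈ᴹ-sym ; trans = ≈ᴹ-trans }
                  ; ∙-cong = +ᴹ-cong
                  }
                ; assoc = λ _ _ _ → +ᴹ-assoc _ _ _
                }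
              ; identity = (λ _ → +ᴹ-identityˡ _) , (λ _ → +ᴹ-identityʳ _)
              }
            ; comm = λ _ _ → +ᴹ-comm _ _
            }
          ; isPreleftSemimodule = record
            { *ₗ-cong      = *ₗ-cong
            ; *ₗ-zeroˡ     = λ _ → *ₗ-zeroˡ _
            ; *ₗ-distribʳ  = λ _ _ _ → *ₗ-distribʳ _ _ _
            ; *ₗ-identityˡ = λ _ → *ₗ-identityˡ _
            ; *ₗ-assoc     = λ _ _ _ → *ₗ-assoc _ _ _
            ; *ₗ-zeroʳ     = λ _ → *ₗ-zeroʳ _
            ; *ₗ-distribˡ  = λ _ _ _ → *ₗ-distribˡ _ _ _
            }
          }
        ; -ᴹ‿cong    = -ᴹ‿cong
        ; -ᴹ‿inverse = (λ _ → -ᴹ‿inverseˡ _) , (λ _ → -ᴹ‿inverseʳ _)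
        }
      }
    ; one          = one , one∈
    ; compose      = λ e x i y → compose e (proj₁ x) i (proj₁ y) , compose∈ e i (proj₂ x) (proj₂ y)
    ; compose-cong = λ e i p q → compose-cong e i p q
    ; +-linearˡ    = λ e i _ _ _ → +-linearˡ e i _ _ _
    ; +-linearʳ    = λ e i _ _ _ → +-linearʳ e i _ _ _
    ; *-linearˡ    = λ e i r _ _ → *-linearˡ e i r _ _
    ; *-linearʳ    = λ e i r _ _ → *-linearʳ e i r _ _
    ; identityˡ    = λ e i _ → identityˡ e i _
    ; identityʳ    = λ e i _ → identityʳ e i _
    ; sequential   = λ e₁ e₂ e₃ e₄ _ _ _ → sequential e₁ e₂ e₃ e₄ _ _ _
    ; parallel     = λ e₁ e₂ e₃ e₄ _ _ _ → parallel e₁ e₂ e₃ e₄ _ _ _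
    }
    where
    open Operad 𝒪
    open Space

  infixl 7 _/_

  _/_ : ∀ {a b g} (𝒪 : Operad a b) → (∀ {n} → Pred (Operad.Element 𝒪 n) g) →
        Operad a (c ⊔ a ⊔ b ⊔ g)
  _/_ 𝒪 R = record
    { space        = λ n → record
      { Carrierᴹ = Element n
      ; _≈ᴹ_     = _~_
      ; _+ᴹ_     = _+ᴹ_
      ; _*ₗ_     = _*ₗ_
      ; 0ᴹ       = 0ᴹ
      ; -ᴹ_      = -ᴹ_
      ; isLeftModule = record
        { isLeftSemimodule = record
          { +ᴹ-isCommutativeMonoid = record
            { isMonoid = record
              { isSemigroup = record
                { isMagma = record
                  { isEquivalence = record { refl = ≈⇒~ ≈ᴹ-refl ; sym = ~-sym ; trans = ~-trans }
                  ; ∙-cong = +-cong~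
                  }
                ; assoc = λ _ _ _ → ≈⇒~ (+ᴹ-assoc _ _ _)
                }
              ; identity = (λ _ → ≈⇒~ (+ᴹ-identityˡ _)) , (λ _ → ≈⇒~ (+ᴹ-identityʳ _))
              }
            ; comm = λ _ _ → ≈⇒~ (+ᴹ-comm _ _)
            }
          ; isPreleftSemimodule = record
            { *ₗ-cong      = λ {r} p q → ~-trans (*-cong~ r q) (≈⇒~ (*ₗ-cong p ≈ᴹ-refl))
            ; *ₗ-zeroˡ     = λ _ → ≈⇒~ (*ₗ-zeroˡ _)
            ; *ₗ-distribʳ  = λ _ _ _ → ≈⇒~ (*ₗ-distribʳ _ _ _)
            ; *ₗ-identityˡ = λ _ → ≈⇒~ (*ₗ-identityˡ _)
            ; *ₗ-assoc     = λ _ _ _ → ≈⇒~ (*ₗ-assoc _ _ _)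
            ; *ₗ-zeroʳ     = λ _ → ≈⇒~ (*ₗ-zeroʳ _)
            ; *ₗ-distribˡ  = λ _ _ _ → ≈⇒~ (*ₗ-distribˡ _ _ _)
            }
          }
        ; -ᴹ‿cong    = λ {x} {y} p → ~-trans (≈⇒~ (≈ᴹ-sym (neg≈ (space n) x)))
                                     (~-trans (*-cong~ (- 1#) p) (≈⇒~ (neg≈ (space n) y)))
        ; -ᴹ‿inverse = (λ _ → ≈⇒~ (-ᴹ‿inverseˡ _)) , (λ _ → ≈⇒~ (-ᴹ‿inverseʳ _))
        }
      }
    ; one          = one
    ; compose      = compose
    ; compose-cong = λ e i {x} {x′} {y} {y′} p q →
        ~-trans (resp∈ (compose-diffˡ e i x x′ y) (composeˡ∈ e i y p))
                (resp∈ (compose-diffʳ e i x′ y y′) (composeʳ∈ e x′ i q))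
    ; +-linearˡ    = λ e i x x′ y → ≈⇒~ (+-linearˡ e i x x′ y)
    ; +-linearʳ    = λ e i x y y′ → ≈⇒~ (+-linearʳ e i x y y′)
    ; *-linearˡ    = λ e i r x y → ≈⇒~ (*-linearˡ e i r x y)
    ; *-linearʳ    = λ e i r x y → ≈⇒~ (*-linearʳ e i r x y)
    ; identityˡ    = λ e i x → ≈⇒~ (identityˡ e i x)
    ; identityʳ    = λ e i x → ≈⇒~ (identityʳ e i x)
    ; sequential   = λ e₁ e₂ e₃ e₄ x y z i j k eq → ≈⇒~ (sequential e₁ e₂ e₃ e₄ x y z i j k eq)
    ; parallel     = λ e₁ e₂ e₃ e₄ x y z i j i′ j′ lt ei ej →
        ≈⇒~ (parallel e₁ e₂ e₃ e₄ x y z i j i′ j′ lt ei ej)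
    }
    where
    open Operad 𝒪
    open Space

    infix 4 _~_
    _~_ : ∀ {n} → Rel (Element n) _
    x ~ y = Ideal 𝒪 R (x +ᴹ -ᴹ y)

    ≈⇒~ : ∀ {n} {x y : Element n} → x ≈ᴹ y → x ~ y
    ≈⇒~ {n} p = resp∈ (≈⇒diff (space n) p) 0∈

    ~-sym : ∀ {n} {x y : Element n} → x ~ y → y ~ x
    ~-sym {n} {x} {y} p = resp∈ (neg-diff (space n) x y) (*∈ (- 1#) p)

    ~-trans : ∀ {n} {x y z : Element n} → x ~ y → y ~ z → x ~ z
    ~-trans {n} {x} {y} {z} p q = resp∈ (diff-trans (space n) x y z) (+∈ p q)

    +-cong~ : ∀ {n} {x x′ y y′ : Element n} → x ~ x′ → y ~ y′ → x +ᴹ y ~ x′ +ᴹ y′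
    +-cong~ {n} {x} {x′} {y} {y′} p q = resp∈ (diff-+ (space n) x x′ y y′) (+∈ p q)

    *-cong~ : ∀ {n} r {x y : Element n} → x ~ y → r *ₗ x ~ r *ₗ y
    *-cong~ {n} r {x} {y} p = resp∈ (diff-* (space n) r x y) (*∈ r p)

    compose-diffˡ : ∀ {m n p} (e : suc p ≡ m ℕ.+ n) i (x x′ : Element m) (y : Element n) →
                    compose e (x +ᴹ -ᴹ x′) i y ≈ᴹ compose e x i y +ᴹ -ᴹ (compose e x′ i y)
    compose-diffˡ {m} {n} {p} e i x x′ y = begin
      compose e (x +ᴹ -ᴹ x′) i y                       ≈⟨ +-linearˡ e i x (-ᴹ x′) y ⟩
      compose e x i y +ᴹ compose e (-ᴹ x′) i y         ≈⟨ +ᴹ-cong ≈ᴹ-refl (compose-cong e i (neg≈ (space m) x′) ≈ᴹ-refl) ⟨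
      compose e x i y +ᴹ compose e ((- 1#) *ₗ x′) i y  ≈⟨ +ᴹ-cong ≈ᴹ-refl (*-linearˡ e i (- 1#) x′ y) ⟩
      compose e x i y +ᴹ (- 1#) *ₗ compose e x′ i y    ≈⟨ +ᴹ-cong ≈ᴹ-refl (neg≈ (space p) _) ⟩
      compose e x i y +ᴹ -ᴹ (compose e x′ i y)         ∎
      where
      open SetoidReasoning (≈ᴹ-setoid {p})

    compose-diffʳ : ∀ {m n p} (e : suc p ≡ m ℕ.+ n) i (x : Element m) (y y′ : Element n) →
                    compose e x i (y +ᴹ -ᴹ y′) ≈ᴹ compose e x i y +ᴹ -ᴹ (compose e x i y′)
    compose-diffʳ {m} {n} {p} e i x y y′ = begin
      compose e x i (y +ᴹ -ᴹ y′)                       ≈⟨ +-linearʳ e i x y (-ᴹ y′) ⟩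
      compose e x i y +ᴹ compose e x i (-ᴹ y′)         ≈⟨ +ᴹ-cong ≈ᴹ-refl (compose-cong e i ≈ᴹ-refl (neg≈ (space n) y′)) ⟨
      compose e x i y +ᴹ compose e x i ((- 1#) *ₗ y′)  ≈⟨ +ᴹ-cong ≈ᴹ-refl (*-linearʳ e i (- 1#) x y′) ⟩
      compose e x i y +ᴹ (- 1#) *ₗ compose e x i y′    ≈⟨ +ᴹ-cong ≈ᴹ-refl (neg≈ (space p) _) ⟩
      compose e x i y +ᴹ -ᴹ (compose e x i y′)         ∎
      where
      open SetoidReasoning (≈ᴹ-setoid {p})

  data Span {a b g : Level} (M : LeftModule ring a b) (G : Pred (LeftModule.Carrierᴹ M) g) :
            Pred (LeftModule.Carrierᴹ M) (c ⊔ a ⊔ b ⊔ g) where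
    gen   : ∀ {x} → G x → Span M G x
    0∈    : Span M G (LeftModule.0ᴹ M)
    +∈    : ∀ {x y} → Span M G x → Span M G y → Span M G (LeftModule._+ᴹ_ M x y)
    *∈    : ∀ r {x} → Span M G x → Span M G (LeftModule._*ₗ_ M r x)
    resp∈ : ∀ {x y} → LeftModule._≈ᴹ_ M x y → Span M G x → Span M G y

  Free : (ℕ → Set) → Operad c (c ⊔ ℓ)
  Free 𝔊 = linearize (Trees.treeOperad 𝔊)

  InducedSpace : (𝔊 : ℕ → Set) → (∀ {n} → Rel (Trees.Component 𝔊 n) 0ℓ) →
                 ∀ {n} → Pred (Operad.Element (Free 𝔊) n) (c ⊔ ℓ)
  InducedSpace 𝔊 _↔_ {n} =
    Span (Operad.space (Free 𝔊) n) (λ v → ∃₂ λ x x′ → x ↔ x′ × v ≡ ⟨ x ⟩ ⊖ ⟨ x′ ⟩)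

  IsPresentation : ∀ {a b g} (𝒪 : Operad a b) (𝔊 : ℕ → Set) →
                   (∀ {n} → Pred (Operad.Element (Free 𝔊) n) g) → Set (a ⊔ b ⊔ c ⊔ ℓ ⊔ g)
  IsPresentation 𝒪 𝔊 ℜ = (Free 𝔊 / ℜ) ≅ 𝒪

-- The letter 0 is zero, and a : Fin γ stands for the element a + 1 of [γ],
-- which as a letter is suc a.

module Letters (γ : ℕ) where

  open NaturalChoiceMax (Finₚ.≤-totalOrder (suc γ)) public using (⊔-isMonoid) renaming (_⊔_ to max)

  max-isMonoid : IsMonoid _≡_ max zero
  max-isMonoid = ⊔-isMonoid {⊤ = zero} (λ _ → z≤n)

  open Words max-isMonoid public using (wordOperad)

  word₂ : (a b : Fin (suc γ)) → SetOperad.Component wordOperad 2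
  word₂ a b = a ∷ b ∷ [] , refl

module _ {c ℓ : Level} (𝕂 : CommutativeRing c ℓ) (γ : ℕ) where
  open Linear 𝕂
  open Letters γ

  Tℳ : Operad c (c ⊔ ℓ)
  Tℳ = linearize wordOperad

  data TriasGenerator : ∀ {n} → Pred (Operad.Element Tℳ n) c where
    word-0a : (a : Fin γ) → TriasGenerator ⟨ word₂ zero (suc a) ⟩
    word-00 : TriasGenerator ⟨ word₂ zero zero ⟩
    word-a0 : (a : Fin γ) → TriasGenerator ⟨ word₂ (suc a) zero ⟩

  Trias : Operad (c ⊔ ℓ) (c ⊔ ℓ)
  Trias = suboperad Tℳ TriasGenerator

data TriasSymbol (γ : ℕ) : ℕ → Set where
  ⊣ ⊢ : Fin γ → TriasSymbol γ 2
  ⊥   : TriasSymbol γ 2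

module TriasRelations (γ : ℕ) where
  open Trees (TriasSymbol γ) using (Component; compose; generator)

  infix 5 _∘₁_ _∘₂_

  _∘₁_ _∘₂_ : TriasSymbol γ 2 → TriasSymbol γ 2 → Component 3
  x ∘₁ y = compose refl (generator x) zero (generator y)
  x ∘₂ y = compose refl (generator x) (suc zero) (generator y)

  infix 4 _↝_ _↔_

  data _↝_ : ∀ {n} → Rel (Component n) 0ℓ where
    ⊥⊥   : ⊥ ∘₁ ⊥ ↝ ⊥ ∘₂ ⊥
    ⊣⊥   : ∀ a → ⊣ a ∘₁ ⊥ ↝ ⊥ ∘₂ ⊣ a
    ⊥⊢   : ∀ a → ⊥ ∘₁ ⊢ a ↝ ⊢ a ∘₂ ⊥
    ⊥⊣   : ∀ a → ⊥ ∘₁ ⊣ a ↝ ⊥ ∘₂ ⊢ a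
    ⊣⊢   : ∀ a a′ → ⊣ a ∘₁ ⊢ a′ ↝ ⊢ a′ ∘₂ ⊣ a
    ⊣⊣-< : ∀ {a b} → a Fin.< b → ⊣ a ∘₁ ⊣ b ↝ ⊣ a ∘₂ ⊢ b
    ⊢⊣-< : ∀ {a b} → a Fin.< b → ⊢ a ∘₁ ⊣ b ↝ ⊢ a ∘₂ ⊢ b
    ⊣⊣-> : ∀ {a b} → a Fin.< b → ⊣ b ∘₁ ⊣ a ↝ ⊣ a ∘₂ ⊣ b
    ⊢⊢-< : ∀ {a b} → a Fin.< b → ⊢ a ∘₁ ⊢ b ↝ ⊢ b ∘₂ ⊢ a
    ⊣₁   : ∀ d → ⊣ d ∘₁ ⊣ d ↝ ⊣ d ∘₂ ⊥
    ⊣₂   : ∀ {c d} → c Fin.≤ d → ⊣ d ∘₂ ⊥ ↝ ⊣ d ∘₂ ⊣ c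
    ⊣₃   : ∀ {c d} → c Fin.≤ d → ⊣ d ∘₂ ⊣ c ↝ ⊣ d ∘₂ ⊢ c
    ⊢₁   : ∀ {c d} → c Fin.≤ d → ⊢ d ∘₁ ⊣ c ↝ ⊢ d ∘₁ ⊢ c
    ⊢₂   : ∀ {c d} → c Fin.≤ d → ⊢ d ∘₁ ⊢ c ↝ ⊢ d ∘₁ ⊥
    ⊢₃   : ∀ d → ⊢ d ∘₁ ⊥ ↝ ⊢ d ∘₂ ⊢ d

  _↔_ : ∀ {n} → Rel (Component n) 0ℓ
  _↔_ = EqClosure _↝_

{-# OPTIONS --safe #-}
module Submission where

open import Defs
open import Level using (Level; _⊔_)
open import Algebra.Apartness.Bundles using (HeytingField)
open import Algebra.Bundles using (CommutativeRing)
open import Algebra.Module.Bundles using (LeftModule)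
open import Algebra.Structures using (IsMonoid)
import Algebra.Properties.Group as GroupProperties
import Algebra.Construct.NaturalChoice.Max as NaturalChoiceMax
open import Data.Fin.Base as Fin using (Fin; zero; suc; toℕ)
import Data.Fin.Properties as Finₚ
open import Data.List.Base using (List; []; _∷_; _++_; map; foldl; foldr; length)
open import Data.List.Membership.Propositional using (_∈_)
open import Data.List.Membership.Propositional.Properties using (∈-++⁺ˡ; ∈-++⁺ʳ)
import Data.List.Properties as Listₚ
open import Data.List.NonEmpty.Base as List⁺ using (List⁺; _∷_; _⁺++⁺_; toList)
open import Data.List.Relation.Unary.Any using (here; there)
open import Data.Nat.Base as ℕ using (ℕ; zero; suc; s≤s)
import Data.Nat.Properties as ℕₚ
open import Data.Product.Base using (Σ-syntax; ∃; _,_; proj₁)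
open import Data.Sum.Base using (inj₁; inj₂)
open import Data.Vec.Base using ([]; _∷_)
open import Function.Base using (_∘_)
open import Relation.Binary.Bundles using (Setoid)
import Relation.Binary.Construct.Closure.Equivalence as EqClosure
open import Relation.Binary.Construct.Closure.ReflexiveTransitive using (ε; _◅_)
open import Relation.Binary.Construct.Closure.Symmetric using (fwd; bwd)
open import Relation.Binary.PropositionalEquality
  using (_≡_; refl; sym; trans; cong; cong₂; subst; module ≡-Reasoning)
import Relation.Binary.Reasoning.Setoid as SetoidReasoning
open import Relation.Nullary using (yes; no; contradiction)
open import Relation.Unary using (Pred)

-- Evaluating trees in Tℳ is compatible with the relations, so it induces a
-- surjective morphism from the quotient onto Trias.  Writing ⊣₀ = ⊢₀ = ⊥, the
-- relations say that, for all letters d and e,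
--   x ⊣d (y ⊣e z) = (x ⊣d y) ⊣(d∨e) z,   x ⊣d (y ⊢e z) = (x ⊣(d∨e) y) ⊣d z,
-- their mirror images, and (x ⊢d y) ⊣e z = x ⊢d (y ⊣e z).  Hence x ⊣d t depends
-- only on x and on the word w of t: it is obtained from x by appending the letters
-- of d∨w one at a time, and dually for t ⊢d x.  So a tree with word u0v, u without
-- zeros, is congruent to the comb that starts from a leaf, appends the letters
-- of v and prepends those of u.  The linear extension of u0v ↦ comb is a left
-- inverse of the evaluation.

module _ (P : SetOperad) where
  open SetOperad P

  -- A component knows its arity only up to an equation. Replacing the object by an equal `t`, and
  -- the position by any `j` of the same value, lets nested composites be computed without
  -- transports.
  proj₁-compose : ∀ {m n p} (e : suc p ≡ m ℕ.+ n) (x : Component m) {i} (y : Component n) {t} →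
                  proj₁ x ≡ t → (j : Fin (arity t)) → toℕ j ≡ toℕ i →
                  proj₁ (compose e x i y) ≡ t ∘[ j ] proj₁ y
  proj₁-compose e (x , refl) (y , refl) refl j q =
    cong (λ i → x ∘[ i ] y) (Finₚ.toℕ-injective (sym q))

-- Evaluation of trees as words.

module Evaluation (γ : ℕ) where
  open Letters γ using (max; max-isMonoid; wordOperad; word₂)
  open Words max-isMonoid using (sub; sub-map-++; sub-++ʳ; toList-injective; toList-substitute)
  open IsMonoid max-isMonoid public using (assoc; identityˡ; identityʳ)
  open NaturalChoiceMax (Finₚ.≤-totalOrder (suc γ)) using (x≤y⇒x⊔y≈y; x≤y⇒y⊔x≈y)
  open Trees (TriasSymbol γ)
  open TriasRelations γ
  module W = SetOperad wordOperad

  Letter : Set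
  Letter = Fin (suc γ)

  node₂ : TriasSymbol γ 2 → Tree → Tree → Tree
  node₂ f s t = node f (s ∷ t ∷ [])

  letterˡ letterʳ : TriasSymbol γ 2 → Letter
  letterˡ (⊣ a) = zero
  letterˡ (⊢ a) = suc a
  letterˡ ⊥     = zero
  letterʳ (⊣ a) = suc a
  letterʳ (⊢ a) = zero
  letterʳ ⊥     = zero

  -- The word `ab` with `u` substituted for its first letter and `v` for its second: the value in
  -- `Tℳ` of a node above trees of values `u` and `v`.
  concat₂ : Letter → Letter → List⁺ Letter → List⁺ Letter → List⁺ Letter
  concat₂ a b u v = List⁺.map (max a) u ⁺++⁺ List⁺.map (max b) v

  -- Only matching on the symbol reveals that the arity is 2, hence one clause per symbol. The
  -- inductions below are split likewise, with the common step stated for `node₂`.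
  word : Tree → List⁺ Letter
  word leaf                      = zero ∷ []
  word (node (⊣ a) (s ∷ t ∷ [])) = concat₂ zero (suc a) (word s) (word t)
  word (node (⊢ a) (s ∷ t ∷ [])) = concat₂ (suc a) zero (word s) (word t)
  word (node ⊥     (s ∷ t ∷ [])) = concat₂ zero zero (word s) (word t)

  letters : Tree → List Letter
  letters t = toList (word t)

  word-node₂ : ∀ f s t → word (node₂ f s t) ≡ concat₂ (letterˡ f) (letterʳ f) (word s) (word t)
  word-node₂ (⊣ a) s t = refl
  word-node₂ (⊢ a) s t = refl
  word-node₂ ⊥     s t = refl

  letters-node₂ : ∀ f s t → letters (node₂ f s t) ≡
                  map (max (letterˡ f)) (letters s) ++ map (max (letterʳ f)) (letters t)
  letters-node₂ f s t = cong toList (word-node₂ f s t)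

  mutual
    length-letters : ∀ t → length (letters t) ≡ leaves t
    length-letters leaf                        = refl
    length-letters (node f@(⊣ a) (s ∷ t ∷ [])) = length-node₂ f s t
    length-letters (node f@(⊢ a) (s ∷ t ∷ [])) = length-node₂ f s t
    length-letters (node f@⊥     (s ∷ t ∷ [])) = length-node₂ f s t

    length-node₂ : ∀ f s t → length (letters (node₂ f s t)) ≡ leaves (node₂ f s t)
    length-node₂ f s t = begin
      length (letters (node₂ f s t))                ≡⟨ cong length (letters-node₂ f s t) ⟩
      length (map _ (letters s) ++ map _ (letters t))
        ≡⟨ Listₚ.length-++ (map (max (letterˡ f)) (letters s)) ⟩
      length (map _ (letters s)) ℕ.+ length (map _ (letters t))
        ≡⟨ cong₂ ℕ._+_ (Listₚ.length-map (max (letterˡ f)) (letters s))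
                       (Listₚ.length-map (max (letterʳ f)) (letters t)) ⟩
      length (letters s) ℕ.+ length (letters t)
        ≡⟨ cong₂ ℕ._+_ (length-letters s) (trans (length-letters t) (sym (ℕₚ.+-identityʳ _))) ⟩
      leaves s ℕ.+ (leaves t ℕ.+ 0) ∎
      where open ≡-Reasoning

  mutual
    letters-graft : ∀ s i u (k : Fin (length (letters s))) → toℕ k ≡ toℕ i →
                    letters (graft s i u) ≡ sub (letters s) k (letters u)
    letters-graft leaf zero u zero e =
      sym (trans (Listₚ.++-identityʳ _) (trans (Listₚ.map-cong identityˡ _) (Listₚ.map-id _)))
    letters-graft (node f@(⊣ a) (s ∷ t ∷ [])) i u k e = letters-graft₂ f s t i u refl k e
    letters-graft (node f@(⊢ a) (s ∷ t ∷ [])) i u k e = letters-graft₂ f s t i u refl k e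
    letters-graft (node f@⊥     (s ∷ t ∷ [])) i u k e = letters-graft₂ f s t i u refl k e

    -- Grafting into a subtree is substituting into the corresponding half of the word, which
    -- commutes with `map (max _)` by associativity of `max`. The type of `k` depends on the word,
    -- so the word is a variable `w` with an equation.
    letters-graft₂ : ∀ f s t i u {w} → w ≡ letters (node₂ f s t) →
                     (k : Fin (length w)) → toℕ k ≡ toℕ i →
                     letters (graft (node₂ f s t) i u) ≡ sub w k (letters u)
    letters-graft₂ f s t i u {w} eq k e with view (leaves s) i
    ... | left i₁ q = begin
      letters (graft (node₂ f s t) i u)
        ≡⟨ cong (letters ∘ node f) (graft-left s (t ∷ []) i u i₁ q) ⟩
      letters (node₂ f (graft s i₁ u) t)
        ≡⟨ letters-node₂ f (graft s i₁ u) t ⟩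
      map (max (letterˡ f)) (letters (graft s i₁ u)) ++ _
        ≡⟨ cong (λ v → map (max (letterˡ f)) v ++ _) (letters-graft s i₁ u i₁′ (Finₚ.toℕ-cast _ i₁)) ⟩
      map (max (letterˡ f)) (sub (letters s) i₁′ (letters u)) ++ _
        ≡⟨ sub-map-++ (letterˡ f) (letters s) _ i₁′ (letters u) (trans eq (letters-node₂ f s t)) k
             (trans e (trans q (sym (Finₚ.toℕ-cast _ i₁)))) ⟨
      sub w k (letters u) ∎
      where
      open ≡-Reasoning
      i₁′ = Fin.cast (sym (length-letters s)) i₁
    ... | right i₂ q with view (leaves t) i₂
    -- The right case would be a leaf of the empty vector of trees.
    ...   | left i₃ r = begin
      letters (graft (node₂ f s t) i u)
        ≡⟨ cong (letters ∘ node f) (trans (graft-right s (t ∷ []) i u i₂ q)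
             (cong (s ∷_) (graft-left t [] i₂ u i₃ r))) ⟩
      letters (node₂ f s (graft t i₃ u))
        ≡⟨ letters-node₂ f s (graft t i₃ u) ⟩
      p ++ map (max (letterʳ f)) (letters (graft t i₃ u))
        ≡⟨ cong (λ v → p ++ map (max (letterʳ f)) v) (letters-graft t i₃ u i₃′ (Finₚ.toℕ-cast _ i₃)) ⟩
      p ++ map (max (letterʳ f)) (sub (letters t) i₃′ (letters u))
        ≡⟨ cong (p ++_) (Listₚ.++-identityʳ _) ⟨
      p ++ (map (max (letterʳ f)) (sub (letters t) i₃′ (letters u)) ++ [])
        ≡⟨ cong (p ++_) (sub-map-++ (letterʳ f) (letters t) [] i₃′ (letters u)
             (sym (Listₚ.++-identityʳ _)) i₄ (trans (Finₚ.toℕ-cast _ i₃) (sym (Finₚ.toℕ-cast _ i₃)))) ⟨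
      p ++ sub (map (max (letterʳ f)) (letters t)) i₄ (letters u)
        ≡⟨ sub-++ʳ p (map (max (letterʳ f)) (letters t)) i₄ (letters u)
             (trans eq (letters-node₂ f s t)) k position ⟨
      sub w k (letters u) ∎
      where
      open ≡-Reasoning
      p   = map (max (letterˡ f)) (letters s)
      i₃′ = Fin.cast (sym (length-letters t)) i₃
      i₄  = Fin.cast (sym (trans (Listₚ.length-map (max (letterʳ f)) (letters t)) (length-letters t))) i₃
      position : toℕ k ≡ length p ℕ.+ toℕ i₄
      position = trans e (trans q (cong₂ ℕ._+_
        (sym (trans (Listₚ.length-map _ (letters s)) (length-letters s)))
        (trans r (sym (Finₚ.toℕ-cast _ i₃)))))

  evaluate : ∀ {n} → Component n → W.Component n
  evaluate (t , p) = word t , trans (length-letters t) p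

  evaluate-compose : ∀ {m n p} (e : suc p ≡ m ℕ.+ n) (x : Component m) i (y : Component n) →
                     evaluate (compose e x i y) ≡ W.compose e (evaluate x) i (evaluate y)
  evaluate-compose e x@(s , refl) i y@(t , refl) = W.Component-≡ (toList-injective (begin
    letters (graft s i t)                    ≡⟨ letters-graft s i t j (Finₚ.toℕ-cast _ i) ⟩
    sub (letters s) j (letters t)            ≡⟨ toList-substitute (word s) j (word t) ⟨
    toList (word s W.∘[ j ] word t)
      ≡⟨ cong toList (proj₁-compose wordOperad e (evaluate x) (evaluate y) refl j (Finₚ.toℕ-cast _ i)) ⟨
    toList (proj₁ (W.compose e (evaluate x) i (evaluate y))) ∎))
    where
    open ≡-Reasoning
    j = Fin.cast (sym (length-letters s)) i

  evaluate-generator : ∀ f → evaluate (generator f) ≡ word₂ (letterˡ f) (letterʳ f)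
  evaluate-generator f = W.Component-≡ (trans (word-node₂ f leaf leaf)
    (cong₂ (λ a b → a ∷ b ∷ []) (identityʳ (letterˡ f)) (identityʳ (letterʳ f))))

  -- The relations hold for words.

  max-< : ∀ {a b : Fin γ} → a Fin.< b → max (suc a) (suc b) ≡ suc b
  max-< a<b = x≤y⇒x⊔y≈y (s≤s (ℕₚ.<⇒≤ a<b))

  max-≥ : ∀ {a b : Fin γ} → b Fin.≤ a → max (suc a) (suc b) ≡ suc a
  max-≥ b≤a = x≤y⇒y⊔x≈y (s≤s b≤a)

  letters-∘₁ : ∀ f g → letters (proj₁ (f ∘₁ g)) ≡
               max (letterˡ f) (letterˡ g) ∷ max (letterˡ f) (letterʳ g) ∷ letterʳ f ∷ []
  letters-∘₁ f g
    rewrite word-node₂ f (node₂ g leaf leaf) leaf | word-node₂ g leaf leaf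
          | identityʳ (letterˡ g) | identityʳ (letterʳ g) | identityʳ (letterʳ f) = refl

  letters-∘₂ : ∀ f g → letters (proj₁ (f ∘₂ g)) ≡
               letterˡ f ∷ max (letterʳ f) (letterˡ g) ∷ max (letterʳ f) (letterʳ g) ∷ []
  letters-∘₂ f g
    rewrite word-node₂ f leaf (node₂ g leaf leaf) | word-node₂ g leaf leaf
          | identityʳ (letterˡ g) | identityʳ (letterʳ g) | identityʳ (letterˡ f) = refl

  letters-≡ : ∀ {a b c a′ b′ c′ : Letter} → a ≡ a′ → b ≡ b′ → c ≡ c′ →
              _≡_ {A = List Letter} (a ∷ b ∷ c ∷ []) (a′ ∷ b′ ∷ c′ ∷ [])
  letters-≡ refl refl refl = refl

  module _ (f g f′ g′ : TriasSymbol γ 2) where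

    evaluate-∘₁-∘₂ : max (letterˡ f) (letterˡ g) ≡ letterˡ f′ →
                     max (letterˡ f) (letterʳ g) ≡ max (letterʳ f′) (letterˡ g′) →
                     letterʳ f ≡ max (letterʳ f′) (letterʳ g′) →
                     evaluate (f ∘₁ g) ≡ evaluate (f′ ∘₂ g′)
    evaluate-∘₁-∘₂ p q r = W.Component-≡ (toList-injective
      (trans (letters-∘₁ f g) (trans (letters-≡ p q r) (sym (letters-∘₂ f′ g′)))))

    evaluate-∘₁-∘₁ : max (letterˡ f) (letterˡ g) ≡ max (letterˡ f′) (letterˡ g′) →
                     max (letterˡ f) (letterʳ g) ≡ max (letterˡ f′) (letterʳ g′) →
                     letterʳ f ≡ letterʳ f′ →
                     evaluate (f ∘₁ g) ≡ evaluate (f′ ∘₁ g′)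
    evaluate-∘₁-∘₁ p q r = W.Component-≡ (toList-injective
      (trans (letters-∘₁ f g) (trans (letters-≡ p q r) (sym (letters-∘₁ f′ g′)))))

    evaluate-∘₂-∘₂ : letterˡ f ≡ letterˡ f′ →
                     max (letterʳ f) (letterˡ g) ≡ max (letterʳ f′) (letterˡ g′) →
                     max (letterʳ f) (letterʳ g) ≡ max (letterʳ f′) (letterʳ g′) →
                     evaluate (f ∘₂ g) ≡ evaluate (f′ ∘₂ g′)
    evaluate-∘₂-∘₂ p q r = W.Component-≡ (toList-injective
      (trans (letters-∘₂ f g) (trans (letters-≡ p q r) (sym (letters-∘₂ f′ g′)))))

  -- max zero a does not compute to a.
  0∨ = identityˡ
  _∨0 = identityʳ

  evaluate-↝ : ∀ {n} {r r′ : Component n} → r ↝ r′ → evaluate r ≡ evaluate r′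
  evaluate-↝ ⊥⊥        = evaluate-∘₁-∘₂ ⊥ ⊥ ⊥ ⊥ (0∨ _) refl (sym (0∨ _))
  evaluate-↝ (⊣⊥ a)    = evaluate-∘₁-∘₂ (⊣ a) ⊥ ⊥ (⊣ a) (0∨ _) refl (sym (0∨ _))
  evaluate-↝ (⊥⊢ a)    = evaluate-∘₁-∘₂ ⊥ (⊢ a) (⊢ a) ⊥ (0∨ _) refl (sym (0∨ _))
  evaluate-↝ (⊥⊣ a)    = evaluate-∘₁-∘₂ ⊥ (⊣ a) ⊥ (⊢ a) (0∨ _) refl (sym (0∨ _))
  evaluate-↝ (⊣⊢ a a′) = evaluate-∘₁-∘₂ (⊣ a) (⊢ a′) (⊢ a′) (⊣ a) (0∨ _) refl (sym (0∨ _))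
  evaluate-↝ (⊣⊣-< {a} {b} a<b) =
    evaluate-∘₁-∘₂ (⊣ a) (⊣ b) (⊣ a) (⊢ b) (0∨ _) (trans (0∨ _) (sym (max-< a<b))) (sym (_ ∨0))
  evaluate-↝ (⊢⊣-< {a} {b} a<b) =
    evaluate-∘₁-∘₂ (⊢ a) (⊣ b) (⊢ a) (⊢ b) (_ ∨0) (trans (max-< a<b) (sym (0∨ _))) (sym (0∨ _))
  evaluate-↝ (⊣⊣-> {a} {b} a<b) =
    evaluate-∘₁-∘₂ (⊣ b) (⊣ a) (⊣ a) (⊣ b) (0∨ _) (trans (0∨ _) (sym (_ ∨0))) (sym (max-< a<b))
  evaluate-↝ (⊢⊢-< {a} {b} a<b) =
    evaluate-∘₁-∘₂ (⊢ a) (⊢ b) (⊢ b) (⊢ a) (max-< a<b) (trans (_ ∨0) (sym (0∨ _))) (sym (0∨ _))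
  evaluate-↝ (⊣₁ d) =
    evaluate-∘₁-∘₂ (⊣ d) (⊣ d) (⊣ d) ⊥ (0∨ _) (trans (0∨ _) (sym (_ ∨0))) (sym (_ ∨0))
  evaluate-↝ (⊣₂ {c} {d} c≤d) =
    evaluate-∘₂-∘₂ (⊣ d) ⊥ (⊣ d) (⊣ c) refl refl (trans (_ ∨0) (sym (max-≥ c≤d)))
  evaluate-↝ (⊣₃ {c} {d} c≤d) =
    evaluate-∘₂-∘₂ (⊣ d) (⊣ c) (⊣ d) (⊢ c) refl
      (trans (_ ∨0) (sym (max-≥ c≤d))) (trans (max-≥ c≤d) (sym (_ ∨0)))
  evaluate-↝ (⊢₁ {c} {d} c≤d) =
    evaluate-∘₁-∘₁ (⊢ d) (⊣ c) (⊢ d) (⊢ c)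
      (trans (_ ∨0) (sym (max-≥ c≤d))) (trans (max-≥ c≤d) (sym (_ ∨0))) refl
  evaluate-↝ (⊢₂ {c} {d} c≤d) =
    evaluate-∘₁-∘₁ (⊢ d) (⊢ c) (⊢ d) ⊥ (trans (max-≥ c≤d) (sym (_ ∨0))) refl refl
  evaluate-↝ (⊢₃ d) =
    evaluate-∘₁-∘₂ (⊢ d) ⊥ (⊢ d) (⊢ d) (_ ∨0) (trans (_ ∨0) (sym (0∨ _))) (sym (0∨ _))

  evaluate-↔ : ∀ {n} {r r′ : Component n} → r ↔ r′ → evaluate r ≡ evaluate r′
  evaluate-↔ ε           = refl
  evaluate-↔ (fwd p ◅ q) = trans (evaluate-↝ p) (evaluate-↔ q)
  evaluate-↔ (bwd p ◅ q) = trans (sym (evaluate-↝ p)) (evaluate-↔ q)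

  -- The relations in uniform form, indexed by all letters.

  ⊣⁰ ⊢⁰ : Letter → TriasSymbol γ 2
  ⊣⁰ zero    = ⊥
  ⊣⁰ (suc a) = ⊣ a
  ⊢⁰ zero    = ⊥
  ⊢⁰ (suc a) = ⊢ a

  ↝⇒↔ : ∀ {n} {r r′ : Component n} → r ↝ r′ → r ↔ r′
  ↝⇒↔ p = fwd p ◅ ε

  ↝⇒↔˘ : ∀ {n} {r r′ : Component n} → r ↝ r′ → r′ ↔ r
  ↝⇒↔˘ p = bwd p ◅ ε

  -- Four of the relations in one. They make letters appended on the right commute with letters
  -- prepended on the left.
  ⊢-⊣ : ∀ p q → ⊣⁰ q ∘₁ ⊢⁰ p ↔ ⊢⁰ p ∘₂ ⊣⁰ q
  ⊢-⊣ zero    zero    = ↝⇒↔ ⊥⊥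
  ⊢-⊣ zero    (suc b) = ↝⇒↔ (⊣⊥ b)
  ⊢-⊣ (suc a) zero    = ↝⇒↔ (⊥⊢ a)
  ⊢-⊣ (suc a) (suc b) = ↝⇒↔ (⊣⊢ b a)

  -- The case split is that of `max`. For positive indices, a strictly larger inner index uses a
  -- relation for `a < b`; otherwise the chain of equivalent trees is run backwards to `⊣ a ∘₁ ⊣ a`.
  -- The same holds for `⊣∘₂⊢`.
  ⊣∘₂⊣ : ∀ d q → ⊣⁰ d ∘₂ ⊣⁰ q ↔ ⊣⁰ (max d q) ∘₁ ⊣⁰ d
  ⊣∘₂⊣ zero    q       rewrite identityˡ q = EqClosure.symmetric _↝_ (⊢-⊣ zero q)
  ⊣∘₂⊣ (suc a) zero    rewrite identityʳ (suc a) = ↝⇒↔˘ (⊣₁ a)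
  ⊣∘₂⊣ (suc a) (suc b) with ℕₚ.<-≤-connex (toℕ a) (toℕ b)
  ... | inj₁ a<b rewrite max-< a<b = ↝⇒↔˘ (⊣⊣-> a<b)
  ... | inj₂ b≤a rewrite max-≥ b≤a = bwd (⊣₂ b≤a) ◅ bwd (⊣₁ a) ◅ ε

  ⊣∘₂⊢ : ∀ d p → ⊣⁰ d ∘₂ ⊢⁰ p ↔ ⊣⁰ d ∘₁ ⊣⁰ (max d p)
  ⊣∘₂⊢ zero    zero    rewrite identityˡ (zero {γ}) = ↝⇒↔˘ ⊥⊥
  ⊣∘₂⊢ zero    (suc b) rewrite identityˡ (suc b) = ↝⇒↔˘ (⊥⊣ b)
  ⊣∘₂⊢ (suc a) zero    rewrite identityʳ (suc a) = ↝⇒↔˘ (⊣₁ a)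
  ⊣∘₂⊢ (suc a) (suc b) with ℕₚ.<-≤-connex (toℕ a) (toℕ b)
  ... | inj₁ a<b rewrite max-< a<b = ↝⇒↔˘ (⊣⊣-< a<b)
  ... | inj₂ b≤a rewrite max-≥ b≤a = bwd (⊣₃ b≤a) ◅ bwd (⊣₂ b≤a) ◅ bwd (⊣₁ a) ◅ ε

  -- Mirror image of `⊣∘₂⊢`, as `⊢∘₁⊢` is of `⊣∘₂⊣`; the chain `⊢₁`, `⊢₂`, `⊢₃` is run forwards.
  ⊢∘₁⊣ : ∀ d q → ⊢⁰ d ∘₁ ⊣⁰ q ↔ ⊢⁰ d ∘₂ ⊢⁰ (max d q)
  ⊢∘₁⊣ zero    zero    rewrite identityˡ (zero {γ}) = ↝⇒↔ ⊥⊥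
  ⊢∘₁⊣ zero    (suc b) rewrite identityˡ (suc b) = ↝⇒↔ (⊥⊣ b)
  ⊢∘₁⊣ (suc a) zero    rewrite identityʳ (suc a) = ↝⇒↔ (⊢₃ a)
  ⊢∘₁⊣ (suc a) (suc b) with ℕₚ.<-≤-connex (toℕ a) (toℕ b)
  ... | inj₁ a<b rewrite max-< a<b = ↝⇒↔ (⊢⊣-< a<b)
  ... | inj₂ b≤a rewrite max-≥ b≤a = fwd (⊢₁ b≤a) ◅ fwd (⊢₂ b≤a) ◅ fwd (⊢₃ a) ◅ ε

  ⊢∘₁⊢ : ∀ d p → ⊢⁰ d ∘₁ ⊢⁰ p ↔ ⊢⁰ (max d p) ∘₂ ⊢⁰ d
  ⊢∘₁⊢ zero    p       rewrite identityˡ p = ⊢-⊣ p zero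
  ⊢∘₁⊢ (suc a) zero    rewrite identityʳ (suc a) = ↝⇒↔ (⊢₃ a)
  ⊢∘₁⊢ (suc a) (suc b) with ℕₚ.<-≤-connex (toℕ a) (toℕ b)
  ... | inj₁ a<b rewrite max-< a<b = ↝⇒↔ (⊢⊢-< a<b)
  ... | inj₂ b≤a rewrite max-≥ b≤a = fwd (⊢₂ b≤a) ◅ fwd (⊢₃ a) ◅ ε

-- Congruence of trees modulo the relations.

module Presentation {c ℓ : Level} (𝕂 : CommutativeRing c ℓ) (γ : ℕ) where
  open Linear 𝕂
  open CommutativeRing 𝕂 using () renaming (refl to reflᴷ)
  open Evaluation γ
  open Letters γ using (max; word₂)
  open Trees (TriasSymbol γ)
  open TriasRelations γ

  ℱ : Operad c (c ⊔ ℓ)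
  ℱ = Free (TriasSymbol γ)

  ℛ : ∀ {n} → Pred (Operad.Element ℱ n) (c ⊔ ℓ)
  ℛ = InducedSpace (TriasSymbol γ) _↔_

  𝒬 : Operad c (c ⊔ ℓ)
  𝒬 = ℱ / ℛ

  module 𝒬 = Operad 𝒬
  open 𝒬.Space using (_≈ᴹ_; ≈ᴹ-refl; ≈ᴹ-sym; ≈ᴹ-trans)

  infix 4 _∼_

  -- Bundling the equality of arities with the congruence allows equational reasoning on bare trees;
  -- `∼-elim` returns to any component.
  _∼_ : Tree → Tree → Set (c ⊔ ℓ)
  s ∼ t = Σ[ e ∈ leaves s ≡ leaves t ] _≈ᴹ_ {leaves t} ⟨ s , e ⟩ ⟨ t , refl ⟩

  ≡⇒≈ : ∀ {n} {x y : Component n} → proj₁ x ≡ proj₁ y → ⟨ x ⟩ ≈ᴹ ⟨ y ⟩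
  ≡⇒≈ {x = _ , e} {y = _ , e′} refl with refl ← ℕₚ.≡-irrelevant e e′ = ≈ᴹ-refl

  ∼-intro : ∀ {n} (x y : Component n) {s t} → ⟨ x ⟩ ≈ᴹ ⟨ y ⟩ → proj₁ x ≡ s → proj₁ y ≡ t → s ∼ t
  ∼-intro (_ , e) (_ , refl) p refl refl = e , p

  ∼-elim : ∀ {s t} → s ∼ t → ∀ {n} (p : leaves s ≡ n) (q : leaves t ≡ n) → ⟨ s , p ⟩ ≈ᴹ ⟨ t , q ⟩
  ∼-elim (_ , r) _ refl = ≈ᴹ-trans (≡⇒≈ refl) r

  ∼-refl : ∀ {t} → t ∼ t
  ∼-refl = refl , ≈ᴹ-refl

  ≡⇒∼ : ∀ {s t} → s ≡ t → s ∼ t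
  ≡⇒∼ refl = ∼-refl

  ∼-sym : ∀ {s t} → s ∼ t → t ∼ s
  ∼-sym p@(e , _) = sym e , ≈ᴹ-sym (∼-elim p refl (sym e))

  ∼-trans : ∀ {s t u} → s ∼ t → t ∼ u → s ∼ u
  ∼-trans p@(e , _) q@(e′ , r) = trans e e′ , ≈ᴹ-trans (∼-elim p _ e′) r

  ∼-setoid : Setoid _ _
  ∼-setoid = record
    { Carrier = Tree ; _≈_ = _∼_
    ; isEquivalence = record { refl = ∼-refl ; sym = ∼-sym ; trans = ∼-trans } }

  -- The slots are filled from right to left, here and in `compose₃`, so that the positions still to
  -- be used do not move and the arity equations hold by `refl`.
  compose₂ : ∀ {m n} → TriasSymbol γ 2 → Component m → Component n → Component (n ℕ.+ m)
  compose₂ {m} {n} f s t =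
    compose {suc n} {m} refl (compose {2} {n} refl (generator f) (suc zero) t) zero s

  proj₁-compose₂ : ∀ {m n} f (s : Component m) (t : Component n) →
                   proj₁ (compose₂ f s t) ≡ node₂ f (proj₁ s) (proj₁ t)
  proj₁-compose₂ {m} {n} f s t =
    proj₁-compose treeOperad refl (compose refl (generator f) (suc zero) t) s
      (proj₁-compose treeOperad refl (generator f) t refl (suc zero) refl) zero refl

  -- A node is a composite with a corolla, and composition in the quotient respects congruence.
  node₂-cong : ∀ f {s s′ t t′} → s ∼ s′ → t ∼ t′ → node₂ f s t ∼ node₂ f s′ t′
  node₂-cong f {s} {s′} {t} {t′} (e , p) (e′ , q) =
    ∼-intro (compose₂ f (s , e) (t , e′)) (compose₂ f (s′ , refl) (t′ , refl))
      (𝒬.compose-cong refl zero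
        {⟨ compose refl (generator f) (suc zero) (t , e′) ⟩}
        {⟨ compose refl (generator f) (suc zero) (t′ , refl) ⟩}
        (𝒬.compose-cong refl (suc zero) {⟨ generator f ⟩} {⟨ generator f ⟩} ≈ᴹ-refl q) p)
      (proj₁-compose₂ f (s , e) (t , e′)) (proj₁-compose₂ f (s′ , refl) (t′ , refl))

  compose₃ : ∀ {l m n} → Component 3 → Component l → Component m → Component n →
             Component (n ℕ.+ m ℕ.+ l)
  compose₃ {l} {m} {n} r x y z =
    compose {suc (n ℕ.+ m)} {l} refl
      (compose {suc (suc n)} {m} refl (compose {3} {n} refl r (suc (suc zero)) z) (suc zero) y)
      zero x

  compose₃-cong : ∀ {l m n} {r r′ : Component 3} → r ↔ r′ →
                  (x : Component l) (y : Component m) (z : Component n) →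
                  ⟨ compose₃ r x y z ⟩ ≈ᴹ ⟨ compose₃ r′ x y z ⟩
  compose₃-cong {r = r} {r′} p x y z =
    𝒬.compose-cong refl zero {⟨ rzy r ⟩} {⟨ rzy r′ ⟩} {⟨ x ⟩} {⟨ x ⟩}
      (𝒬.compose-cong refl (suc zero) {⟨ rz r ⟩} {⟨ rz r′ ⟩} {⟨ y ⟩} {⟨ y ⟩}
        (𝒬.compose-cong refl (suc (suc zero)) {⟨ r ⟩} {⟨ r′ ⟩} {⟨ z ⟩} {⟨ z ⟩}
          -- The inner `gen` puts the difference into the span of the relations, the outer one into
          -- the ideal.
          (gen (gen (r , r′ , p , refl))) ≈ᴹ-refl)
        ≈ᴹ-refl)
      ≈ᴹ-refl
    where
    rz  = λ r → compose refl r (suc (suc zero)) z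
    rzy = λ r → compose refl (rz r) (suc zero) y

  whole : (t : Tree) → Component (leaves t)
  whole t = t , refl

  module _ {l m n} (x : Component l) (y : Component m) (z : Component n) where

    proj₁-compose₃ : ∀ r {t} → proj₁ r ≡ t →
                     (i : Fin (leaves t)) → toℕ i ≡ 2 →
                     (j : Fin (leaves (graft t i (proj₁ z)))) → toℕ j ≡ 1 →
                     (k : Fin (leaves (graft (graft t i (proj₁ z)) j (proj₁ y)))) → toℕ k ≡ 0 →
                     proj₁ (compose₃ r x y z) ≡
                     graft (graft (graft t i (proj₁ z)) j (proj₁ y)) k (proj₁ x)
    proj₁-compose₃ r q i qi j qj k qk =
      proj₁-compose treeOperad refl rzy x (proj₁-compose treeOperad refl rz y
        (proj₁-compose treeOperad refl r z q i qi) j qj) k qk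
      where
      rz  = compose refl r (suc (suc zero)) z
      rzy = compose refl rz (suc zero) y

    proj₁-compose₃-∘₁ : ∀ f g → proj₁ (compose₃ (f ∘₁ g) x y z) ≡
                        node₂ f (node₂ g (proj₁ x) (proj₁ y)) (proj₁ z)
    proj₁-compose₃-∘₁ f g =
      proj₁-compose₃ (f ∘₁ g) refl (suc (suc zero)) refl (suc zero) refl zero refl

    proj₁-compose₃-∘₂ : ∀ f g → proj₁ (compose₃ (f ∘₂ g) x y z) ≡
                        node₂ f (proj₁ x) (node₂ g (proj₁ y) (proj₁ z))
    proj₁-compose₃-∘₂ f g =
      proj₁-compose₃ (f ∘₂ g) refl (suc (suc zero)) refl (suc zero) refl zero refl

  -- Grafting `x`, `y`, `z` on the three leaves of both sides turns each relation into a rewriting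
  -- rule for arbitrary trees.
  rotate : ∀ f g f′ g′ x y z → f ∘₁ g ↔ f′ ∘₂ g′ →
           node₂ f (node₂ g x y) z ∼ node₂ f′ x (node₂ g′ y z)
  rotate f g f′ g′ x y z p =
    ∼-intro (compose₃ (f ∘₁ g) x′ y′ z′) (compose₃ (f′ ∘₂ g′) x′ y′ z′) (compose₃-cong p x′ y′ z′)
            (proj₁-compose₃-∘₁ x′ y′ z′ f g) (proj₁-compose₃-∘₂ x′ y′ z′ f′ g′)
    where
    x′ = whole x
    y′ = whole y
    z′ = whole z

  rotate˘ : ∀ f g f′ g′ x y z → f′ ∘₂ g′ ↔ f ∘₁ g →
            node₂ f′ x (node₂ g′ y z) ∼ node₂ f (node₂ g x y) z
  rotate˘ f g f′ g′ x y z p = ∼-sym (rotate f g f′ g′ x y z (EqClosure.symmetric _↝_ p))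

  -- Combs, and absorption of a tree into a comb.

  infixl 5 _⊣[_]_
  infixr 5 _⊢[_]_

  _⊣[_]_ _⊢[_]_ : Tree → Letter → Tree → Tree
  x ⊣[ a ] y = node₂ (⊣⁰ a) x y
  x ⊢[ a ] y = node₂ (⊢⁰ a) x y

  appendLetters : Tree → List Letter → Tree
  appendLetters = foldl (_⊣[_] leaf)

  prependLetters : List Letter → Tree → Tree
  prependLetters u t = foldr (leaf ⊢[_]_) t u

  append-cong : ∀ {s t} → s ∼ t → ∀ v → appendLetters s v ∼ appendLetters t v
  append-cong p []      = p
  append-cong p (a ∷ v) = append-cong (node₂-cong (⊣⁰ a) p ∼-refl) v

  prepend-cong : ∀ {s t} u → s ∼ t → prependLetters u s ∼ prependLetters u t
  prepend-cong []      p = p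
  prepend-cong (a ∷ u) p = node₂-cong (⊢⁰ a) ∼-refl (prepend-cong u p)

  map-max-++ : ∀ d p q u v → map (max d) (map (max p) u ++ map (max q) v) ≡
               map (max (max d p)) u ++ map (max (max d q)) v
  map-max-++ d p q u v = begin
    map (max d) (map (max p) u ++ map (max q) v)               ≡⟨ Listₚ.map-++ (max d) (map (max p) u) _ ⟩
    map (max d) (map (max p) u) ++ map (max d) (map (max q) v) ≡⟨ cong₂ _++_ (fuse p u) (fuse q v) ⟨
    map (max (max d p)) u ++ map (max (max d q)) v             ∎
    where
    open ≡-Reasoning
    fuse : ∀ p u → map (max (max d p)) u ≡ map (max d) (map (max p) u)
    fuse p u = trans (Listₚ.map-cong (assoc d p) u) (Listₚ.map-∘ u)

  map-max-++-zeroˡ : ∀ d q u v → map (max d) (map (max zero) u ++ map (max q) v) ≡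
                     map (max d) u ++ map (max (max d q)) v
  map-max-++-zeroˡ d q u v = trans (map-max-++ d zero q u v)
    (cong (λ e → map (max e) u ++ map (max (max d q)) v) (identityʳ d))

  map-max-++-zeroʳ : ∀ d p u v → map (max d) (map (max p) u ++ map (max zero) v) ≡
                     map (max (max d p)) u ++ map (max d) v
  map-max-++-zeroʳ d p u v = trans (map-max-++ d p zero u v)
    (cong (λ e → map (max (max d p)) u ++ map (max e) v) (identityʳ d))

  open SetoidReasoning ∼-setoid

  mutual
    -- Rotating the root of `t` away leaves two products with its smaller subtrees. Their indices
    -- are the maxima of `d` with the two letters of that root, just as `map (max d)` acts on the
    -- word.
    ⊣-absorb : ∀ x d t → x ⊣[ d ] t ∼ appendLetters x (map (max d) (letters t))
    ⊣-absorb x d leaf rewrite identityʳ d = ∼-refl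
    ⊣-absorb x d (node (⊣ a) (y ∷ z ∷ [])) = ⊣-absorb-⊣ x d (suc a) y z
    ⊣-absorb x d (node ⊥     (y ∷ z ∷ [])) = ⊣-absorb-⊣ x d zero y z
    ⊣-absorb x d (node (⊢ a) (y ∷ z ∷ [])) = begin
      x ⊣[ d ] (y ⊢[ suc a ] z)
        ≈⟨ rotate˘ (⊣⁰ d) (⊣⁰ (max d (suc a))) (⊣⁰ d) (⊢ a) x y z (⊣∘₂⊢ d (suc a)) ⟩
      x ⊣[ max d (suc a) ] y ⊣[ d ] z
        ≈⟨ ⊣-absorb₂ x (max d (suc a)) d y z ⟩
      appendLetters x (map (max (max d (suc a))) (letters y) ++ map (max d) (letters z))
        ≡⟨ cong (appendLetters x) (map-max-++-zeroʳ d (suc a) (letters y) (letters z)) ⟨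
      appendLetters x (map (max d) (letters (y ⊢[ suc a ] z))) ∎

    ⊣-absorb-⊣ : ∀ x d q y z → x ⊣[ d ] (y ⊣[ q ] z) ∼
                 appendLetters x (map (max d) (map (max zero) (letters y) ++ map (max q) (letters z)))
    ⊣-absorb-⊣ x d q y z = begin
      x ⊣[ d ] (y ⊣[ q ] z)
        ≈⟨ rotate˘ (⊣⁰ (max d q)) (⊣⁰ d) (⊣⁰ d) (⊣⁰ q) x y z (⊣∘₂⊣ d q) ⟩
      x ⊣[ d ] y ⊣[ max d q ] z
        ≈⟨ ⊣-absorb₂ x d (max d q) y z ⟩
      appendLetters x (map (max d) (letters y) ++ map (max (max d q)) (letters z))
        ≡⟨ cong (appendLetters x) (map-max-++-zeroˡ d q (letters y) (letters z)) ⟨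
      appendLetters x (map (max d) (map (max zero) (letters y) ++ map (max q) (letters z))) ∎

    ⊣-absorb₂ : ∀ x d e y z → x ⊣[ d ] y ⊣[ e ] z ∼
                appendLetters x (map (max d) (letters y) ++ map (max e) (letters z))
    ⊣-absorb₂ x d e y z = begin
      x ⊣[ d ] y ⊣[ e ] z
        ≈⟨ ⊣-absorb (x ⊣[ d ] y) e z ⟩
      appendLetters (x ⊣[ d ] y) (map (max e) (letters z))
        ≈⟨ append-cong (⊣-absorb x d y) (map (max e) (letters z)) ⟩
      appendLetters (appendLetters x (map (max d) (letters y))) (map (max e) (letters z))
        ≡⟨ Listₚ.foldl-++ _ x (map (max d) (letters y)) (map (max e) (letters z)) ⟨
      appendLetters x (map (max d) (letters y) ++ map (max e) (letters z)) ∎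

  mutual
    -- Mirror image of `⊣-absorb`, rotating the root of the left argument.
    ⊢-absorb : ∀ t d x → t ⊢[ d ] x ∼ prependLetters (map (max d) (letters t)) x
    ⊢-absorb leaf d x rewrite identityʳ d = ∼-refl
    ⊢-absorb (node (⊢ a) (y ∷ z ∷ [])) d x = ⊢-absorb-⊢ y (suc a) z d x
    ⊢-absorb (node ⊥     (y ∷ z ∷ [])) d x = ⊢-absorb-⊢ y zero z d x
    ⊢-absorb (node (⊣ a) (y ∷ z ∷ [])) d x = begin
      (y ⊣[ suc a ] z) ⊢[ d ] x
        ≈⟨ rotate (⊢⁰ d) (⊣ a) (⊢⁰ d) (⊢⁰ (max d (suc a))) y z x (⊢∘₁⊣ d (suc a)) ⟩
      y ⊢[ d ] z ⊢[ max d (suc a) ] x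
        ≈⟨ ⊢-absorb₂ y d z (max d (suc a)) x ⟩
      prependLetters (map (max d) (letters y) ++ map (max (max d (suc a))) (letters z)) x
        ≡⟨ cong (λ w → prependLetters w x) (map-max-++-zeroˡ d (suc a) (letters y) (letters z)) ⟨
      prependLetters (map (max d) (letters (y ⊣[ suc a ] z))) x ∎

    ⊢-absorb-⊢ : ∀ y p z d x → (y ⊢[ p ] z) ⊢[ d ] x ∼
                 prependLetters (map (max d) (map (max p) (letters y) ++ map (max zero) (letters z))) x
    ⊢-absorb-⊢ y p z d x = begin
      (y ⊢[ p ] z) ⊢[ d ] x
        ≈⟨ rotate (⊢⁰ d) (⊢⁰ p) (⊢⁰ (max d p)) (⊢⁰ d) y z x (⊢∘₁⊢ d p) ⟩
      y ⊢[ max d p ] z ⊢[ d ] x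
        ≈⟨ ⊢-absorb₂ y (max d p) z d x ⟩
      prependLetters (map (max (max d p)) (letters y) ++ map (max d) (letters z)) x
        ≡⟨ cong (λ w → prependLetters w x) (map-max-++-zeroʳ d p (letters y) (letters z)) ⟨
      prependLetters (map (max d) (map (max p) (letters y) ++ map (max zero) (letters z))) x ∎

    ⊢-absorb₂ : ∀ y d z e x → y ⊢[ d ] z ⊢[ e ] x ∼
                prependLetters (map (max d) (letters y) ++ map (max e) (letters z)) x
    ⊢-absorb₂ y d z e x = begin
      y ⊢[ d ] z ⊢[ e ] x
        ≈⟨ ⊢-absorb y d (z ⊢[ e ] x) ⟩
      prependLetters (map (max d) (letters y)) (z ⊢[ e ] x)
        ≈⟨ prepend-cong (map (max d) (letters y)) (⊢-absorb z e x) ⟩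
      prependLetters (map (max d) (letters y)) (prependLetters (map (max e) (letters z)) x)
        ≡⟨ Listₚ.foldr-++ (leaf ⊢[_]_) x (map (max d) (letters y)) (map (max e) (letters z)) ⟨
      prependLetters (map (max d) (letters y) ++ map (max e) (letters z)) x ∎

  -- Normal forms of trees.

  -- Junk on words without the letter zero, which are not in Trias.
  normalForm : List Letter → Tree
  normalForm []          = leaf
  normalForm (zero ∷ v)  = appendLetters leaf v
  normalForm (suc a ∷ v) = leaf ⊢[ suc a ] normalForm v

  -- Each appended letter passes under the prepended one by `⊢-⊣`.
  append-⊢ : ∀ a t v → appendLetters (leaf ⊢[ a ] t) v ∼ leaf ⊢[ a ] appendLetters t v
  append-⊢ a t []      = ∼-refl
  append-⊢ a t (b ∷ v) = ∼-trans
    (append-cong (rotate (⊣⁰ b) (⊢⁰ a) (⊢⁰ a) (⊣⁰ b) leaf t leaf (⊢-⊣ a b)) v)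
    (append-⊢ a (t ⊣[ b ] leaf) v)

  -- Since `u` contains a zero, the letters of `v` come after the first zero of `u ++ v`, so
  -- `normalForm` appends them too. Those before that zero are crossed by `append-⊢`.
  append-normalForm : ∀ {u} → zero ∈ u → ∀ v → appendLetters (normalForm u) v ∼ normalForm (u ++ v)
  append-normalForm {zero ∷ u}  _         v = ≡⇒∼ (sym (Listₚ.foldl-++ _ leaf u v))
  append-normalForm {suc a ∷ u} (there p) v = ∼-trans (append-⊢ (suc a) (normalForm u) v)
    (node₂-cong (⊢ a) ∼-refl (append-normalForm p v))

  max-suc : ∀ a (b : Letter) → ∃ λ c → max (suc a) b ≡ suc c
  max-suc a zero    = a , identityʳ (suc a)
  max-suc a (suc b) with ℕₚ.<-≤-connex (toℕ a) (toℕ b)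
  ... | inj₁ a<b = b , max-< a<b
  ... | inj₂ b≤a = a , max-≥ b≤a

  -- By `max-suc` every letter of `map (max (suc a)) u` is nonzero, so `normalForm` takes its
  -- prepending clause on each.
  prepend-normalForm : ∀ a u v → prependLetters (map (max (suc a)) u) (normalForm v) ≡
                                 normalForm (map (max (suc a)) u ++ v)
  prepend-normalForm a []      v = refl
  prepend-normalForm a (b ∷ u) v with max (suc a) b | max-suc a b
  ... | _ | c , refl = cong (leaf ⊢[ suc c ]_) (prepend-normalForm a u v)

  map-max-zero : ∀ u → map (max zero) u ≡ u
  map-max-zero u = trans (Listₚ.map-cong identityˡ u) (Listₚ.map-id u)

  -- Every symbol has a zero letter, and the subtree on that side keeps its own zero.
  zero∈letters : ∀ t → zero ∈ letters t
  zero∈letters leaf                      = here refl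
  zero∈letters (node (⊣ a) (s ∷ t ∷ [])) =
    ∈-++⁺ˡ (subst (zero ∈_) (sym (map-max-zero (letters s))) (zero∈letters s))
  zero∈letters (node ⊥     (s ∷ t ∷ [])) =
    ∈-++⁺ˡ (subst (zero ∈_) (sym (map-max-zero (letters s))) (zero∈letters s))
  zero∈letters (node (⊢ a) (s ∷ t ∷ [])) =
    ∈-++⁺ʳ (map (max (suc a)) (letters s))
      (subst (zero ∈_) (sym (map-max-zero (letters t))) (zero∈letters t))

  mutual
    -- The subtree under the nonzero letter, the right one for `⊥`, is absorbed letter by letter;
    -- the other is normalized by induction.
    normalize : ∀ t → t ∼ normalForm (letters t)
    normalize leaf = ∼-refl
    normalize (node (⊣ a) (s ∷ t ∷ [])) = normalize-⊣ s (suc a) t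
    normalize (node ⊥     (s ∷ t ∷ [])) = normalize-⊣ s zero t
    normalize (node (⊢ a) (s ∷ t ∷ [])) = begin
      s ⊢[ suc a ] t
        ≈⟨ ⊢-absorb s (suc a) t ⟩
      prependLetters (map (max (suc a)) (letters s)) t
        ≈⟨ prepend-cong (map (max (suc a)) (letters s)) (normalize t) ⟩
      prependLetters (map (max (suc a)) (letters s)) (normalForm (letters t))
        ≡⟨ prepend-normalForm a (letters s) (letters t) ⟩
      normalForm (map (max (suc a)) (letters s) ++ letters t)
        ≡⟨ cong (λ v → normalForm (map (max (suc a)) (letters s) ++ v)) (map-max-zero (letters t)) ⟨
      normalForm (letters (s ⊢[ suc a ] t)) ∎

    normalize-⊣ : ∀ s q t → s ⊣[ q ] t ∼
                  normalForm (map (max zero) (letters s) ++ map (max q) (letters t))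
    normalize-⊣ s q t = begin
      s ⊣[ q ] t
        ≈⟨ ⊣-absorb s q t ⟩
      appendLetters s (map (max q) (letters t))
        ≈⟨ append-cong (normalize s) (map (max q) (letters t)) ⟩
      appendLetters (normalForm (letters s)) (map (max q) (letters t))
        ≈⟨ append-normalForm (zero∈letters s) (map (max q) (letters t)) ⟩
      normalForm (letters s ++ map (max q) (letters t))
        ≡⟨ cong (λ u → normalForm (u ++ map (max q) (letters t))) (map-max-zero (letters s)) ⟨
      normalForm (map (max zero) (letters s) ++ map (max q) (letters t)) ∎

  -- The evaluation morphism `Φ` on the quotient.

  open Operad ℱ using () renaming (compose to composeᶠ)
  open Operad (Tℳ 𝕂 γ) using ()
    renaming (compose to composeᵀ; compose-cong to compose-congᵀ)

  Φ : ∀ {n} → Combination (Component n) → Combination (W.Component n)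
  Φ = extend (λ t → ⟨ evaluate t ⟩)

  ≡⇒≋ : {B : Set} {a b : B} → a ≡ b → ⟨ a ⟩ ≋ ⟨ b ⟩
  ≡⇒≋ refl = ≋-refl

  Φ-compose : ∀ {m n p} (e : suc p ≡ m ℕ.+ n) (x : Combination (Component m)) i
              (y : Combination (Component n)) →
              Φ (composeᶠ e x i y) ≋ composeᵀ e (Φ x) i (Φ y)
  Φ-compose e x i y =
    ≋-trans (extend-extend _ _ x)
    (≋-trans (extend-ext (λ s →
        ≋-trans (extend-extend _ _ y)
        (≋-trans (extend-ext (λ t → ≡⇒≋ (evaluate-compose e s i t)) y)
        (≋-sym (extend-extend _ _ y)))) x)
    (≋-sym (extend-extend _ _ x)))

  Φ-ideal : ∀ {n} {x : Combination (Component n)} → Ideal ℱ ℛ x → Φ x ≋ 𝟎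
  Φ-ideal {n} (gen r) = Φ-relation r
    where
    Φ-relation : ∀ {x} → ℛ {n} x → Φ x ≋ 𝟎
    Φ-relation (gen (x , x′ , x↔x′ , refl)) =
      ≋-trans (⊕-cong (≡⇒≋ (evaluate-↔ x↔x′)) ≋-refl) (⊖-inverse _)
    Φ-relation 0∈          = ≋-refl
    Φ-relation (+∈ p q)    = ≋-trans (⊕-cong (Φ-relation p) (Φ-relation q)) (⊕-identityˡ 𝟎)
    Φ-relation (*∈ r p)    = ≋-trans (⊙-cong reflᴷ (Φ-relation p)) (⊙-zeroʳ r)
    Φ-relation (resp∈ e p) = ≋-trans (≋-sym (extend-cong _ e)) (Φ-relation p)
  Φ-ideal (composeˡ∈ e {x} i y p) =
    ≋-trans (Φ-compose e x i y) (extend-cong _ (Φ-ideal p))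
  Φ-ideal (composeʳ∈ e x i {y} p) =
    ≋-trans (Φ-compose e x i y)
    -- Unlike in the first argument, composing with `𝟎` in the second argument does not reduce to
    -- `𝟎`.
    (≋-trans (extend-ext (λ _ → extend-cong _ (Φ-ideal p)) (Φ x)) (extend-𝟎 (Φ x)))
  Φ-ideal 0∈          = ≋-refl
  Φ-ideal (+∈ p q)    = ≋-trans (⊕-cong (Φ-ideal p) (Φ-ideal q)) (⊕-identityˡ 𝟎)
  Φ-ideal (*∈ r p)    = ≋-trans (⊙-cong reflᴷ (Φ-ideal p)) (⊙-zeroʳ r)
  Φ-ideal (resp∈ e p) = ≋-trans (≋-sym (extend-cong _ e)) (Φ-ideal p)

  Φ-cong : ∀ {n} {x y : 𝒬.Element n} → x ≈ᴹ y → Φ x ≋ Φ y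
  Φ-cong {n} {x} {y} p = x∙y⁻¹≈ε⇒x≈y (Φ x) (Φ y) (Φ-ideal p)
    where
    open LeftModule (combinations (W.Component n)) using (+ᴹ-group)
    open GroupProperties +ᴹ-group using (x∙y⁻¹≈ε⇒x≈y)

  ≋⇒≈ : ∀ {n} {x y : 𝒬.Element n} → x ≋ y → x ≈ᴹ y
  ≋⇒≈ {n} p = resp∈ (≈⇒diff (combinations (Component n)) p) 0∈

  -- Injectivity of `Φ`, by a left inverse.

  -- The comb of a word without zero has one leaf too many; such a word is sent to the default `𝟎`.
  section : ∀ {n} → W.Component n → Combination (Component n)
  section {n} (w , _) with leaves (normalForm (toList w)) ℕₚ.≟ n
  ... | yes p = ⟨ normalForm (toList w) , p ⟩
  ... | no  _ = 𝟎

  section-evaluate : ∀ {n} (t : Component n) → ⟨ t ⟩ ≈ᴹ section (evaluate t)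
  section-evaluate {n} (t , p) with leaves (normalForm (letters t)) ℕₚ.≟ n
  ... | yes q = ∼-elim (normalize t) p q
  -- The default is not reached on values of trees, since `normalize` carries the equality of
  -- arities.
  ... | no ¬q = contradiction (trans (sym (proj₁ (normalize t))) p) ¬q

  section-Φ : ∀ {n} (x : 𝒬.Element n) → x ≈ᴹ extend section (Φ x)
  section-Φ ⟨ t ⟩   = section-evaluate t
  section-Φ 𝟎       = ≈ᴹ-refl
  section-Φ {n} (x ⊕ y) =
    𝒬.Space.+ᴹ-cong {n} {x} {extend section (Φ x)} {y} (section-Φ x) (section-Φ y)
  section-Φ {n} (r ⊙ x) = 𝒬.Space.*ₗ-cong {n} {r} {r} {x} reflᴷ (section-Φ x)

  -- As the linear extension of a map on the basis of words, `extend section` respects `≋`, and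
  -- `section-Φ` makes it a left inverse modulo the ideal.
  Φ-injective : ∀ {n} {x y : 𝒬.Element n} → Φ x ≋ Φ y → x ≈ᴹ y
  Φ-injective {x = x} {y} p =
    ≈ᴹ-trans (section-Φ x) (≈ᴹ-trans (≋⇒≈ (extend-cong section p)) (≈ᴹ-sym (section-Φ y)))

  -- The image of `Φ` is `Trias`.

  Generatedᵀ : ∀ {n} → Combination (W.Component n) → Set (c ⊔ ℓ)
  Generatedᵀ = Generated (Tℳ 𝕂 γ) (TriasGenerator 𝕂 γ)

  generator-generated : ∀ f → Generatedᵀ ⟨ evaluate (generator {2} f) ⟩
  generator-generated f = resp∈ (≡⇒≋ (sym (evaluate-generator f))) (gen (isGenerator f))
    where
    isGenerator : ∀ f → TriasGenerator 𝕂 γ ⟨ word₂ (letterˡ f) (letterʳ f) ⟩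
    isGenerator (⊣ a) = word-0a a
    isGenerator (⊢ a) = word-a0 a
    isGenerator ⊥     = word-00

  mutual
    tree-generated : ∀ t → Generatedᵀ ⟨ evaluate (whole t) ⟩
    tree-generated leaf                        = one∈
    tree-generated (node f@(⊣ a) (s ∷ t ∷ [])) = node₂-generated f s t
    tree-generated (node f@(⊢ a) (s ∷ t ∷ [])) = node₂-generated f s t
    tree-generated (node f@⊥     (s ∷ t ∷ [])) = node₂-generated f s t

    node₂-generated : ∀ f s t → Generatedᵀ ⟨ evaluate (whole (node₂ f s t)) ⟩
    node₂-generated f s t =
      subst-generated (proj₁-compose₂ f (whole s) (whole t))
        (resp∈ (≡⇒≋ (sym (evaluate-compose refl ft zero (whole s))))
          (compose∈ refl zero
            (resp∈ (≡⇒≋ (sym (evaluate-compose refl (generator f) (suc zero) (whole t))))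
              (compose∈ refl (suc zero) (generator-generated f) (tree-generated t)))
            (tree-generated s)))
      where
      ft = compose refl (generator f) (suc zero) (whole t)
      -- The composite has the wanted underlying tree but another expression for its arity.
      subst-generated : ∀ {n} {x : Component n} {t} → proj₁ x ≡ t →
                        Generatedᵀ ⟨ evaluate x ⟩ → Generatedᵀ ⟨ evaluate (whole t) ⟩
      subst-generated {x = _ , refl} refl g = g

  Φ-generated : ∀ {n} (x : Combination (Component n)) → Generatedᵀ (Φ x)
  Φ-generated ⟨ t , refl ⟩ = tree-generated t
  Φ-generated 𝟎            = 0∈
  Φ-generated (x ⊕ y)      = +∈ (Φ-generated x) (Φ-generated y)
  Φ-generated (r ⊙ x)      = *∈ r (Φ-generated x)

  -- The image of `Φ` contains the generating words and the unit, and is closed under composition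
  -- and linear combinations.
  Φ-surjective : ∀ {n} {y : Combination (W.Component n)} → Generatedᵀ y → ∃ λ x → Φ x ≋ y
  Φ-surjective (gen g) = generator-preimage g
    where
    preimage : ∀ f → Φ ⟨ generator {2} f ⟩ ≋ ⟨ word₂ (letterˡ f) (letterʳ f) ⟩
    preimage f = ≡⇒≋ (evaluate-generator f)
    generator-preimage : ∀ {n} {y : Combination (W.Component n)} →
                         TriasGenerator 𝕂 γ y → ∃ λ x → Φ x ≋ y
    generator-preimage (word-0a a) = ⟨ generator (⊣ a) ⟩ , preimage (⊣ a)
    generator-preimage word-00     = ⟨ generator ⊥ ⟩ , preimage ⊥
    generator-preimage (word-a0 a) = ⟨ generator (⊢ a) ⟩ , preimage (⊢ a)
  Φ-surjective one∈ = ⟨ whole leaf ⟩ , ≋-refl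
  Φ-surjective (compose∈ e i g h) with Φ-surjective g | Φ-surjective h
  ... | x , p | y , q =
    composeᶠ e x i y , ≋-trans (Φ-compose e x i y) (compose-congᵀ e i p q)
  Φ-surjective 0∈ = 𝟎 , ≋-refl
  Φ-surjective (+∈ g h) with Φ-surjective g | Φ-surjective h
  ... | x , p | y , q = x ⊕ y , ⊕-cong p q
  Φ-surjective (*∈ r g) with Φ-surjective g
  ... | x , p = r ⊙ x , ⊙-cong reflᴷ p
  Φ-surjective (resp∈ e g) with Φ-surjective g
  ... | x , p = x , ≋-trans p e

  -- The isomorphism of operads.

  presentation : IsPresentation (Trias 𝕂 γ) (TriasSymbol γ) ℛ
  presentation = record
    { ⟦_⟧           = λ x → Φ x , Φ-generated x
    ; isIsomorphism = λ {n} → record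
      { isLeftModuleMonomorphism = record
        { isLeftModuleHomomorphism = record
          { +ᴹ-isGroupHomomorphism = record
            { isMonoidHomomorphism = record
              { isMagmaHomomorphism = record
                { isRelHomomorphism = record { cong = Φ-cong }
                ; homo = λ _ _ → ≋-refl
                }
              ; ε-homo = ≋-refl
              }
            ; ⁻¹-homo = λ _ → ≋-refl
            }
          ; *ₗ-homo = λ _ _ → ≋-refl
          }
        ; injective = λ {x} {y} → Φ-injective {n} {x} {y}
        }
      ; surjective = λ (_ , g) → let x , p = Φ-surjective g in
          -- Surjectivity is required of every element congruent to the chosen preimage.
          x , λ q → ≋-trans (Φ-cong q) p
      }
    ; one-homo     = ≋-refl
    ; compose-homo = Φ-compose
    }

theorem4p2p1 : ∀ {c ℓ₁ ℓ₂} (𝕂 : HeytingField c ℓ₁ ℓ₂) → CharacteristicZero 𝕂 →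
    (γ : ℕ) →
    Linear.IsPresentation (fieldRing 𝕂)
      (Trias (fieldRing 𝕂) γ)
      (TriasSymbol γ)
      (Linear.InducedSpace (fieldRing 𝕂) (TriasSymbol γ) (TriasRelations._↔_ γ))
theorem4p2p1 𝕂 _ γ = Presentation.presentation (fieldRing 𝕂) γ
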